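{- Let $m\ge1$. (a) The number of compact magic hypercubes of order $4$ and dimension $m$ is $4^m(2m+1)!$. (b) The number of most-perfect magic hypercubes of order $4$ and dimension $m$ is $4^m(2m)!$.
   Context: Consider arrangements of the numbers $1,2,\ldots,4^m$ (each used once) in a $4\times\cdots\times4$ ($m$-fold) grid with positions indexed by $(\mathbb Z/4\mathbb Z)^m$. Such an arrangement is a compact magic hypercube if all orthogonal lines (four positions obtained by fixing all but one coordinate) and all $2\times2$ subsquares (positions obtained by fixing all but two coordinates and letting those two range over $\{i,i+1\}\times\{k,k+1\}$ modulo $4$, so wrap-around subsquares are included) sum to the same magic constant. A great pandiagonal is a toroidal line $\{p+t\,d: t\in\mathbb Z/4\mathbb Z\}$ with $p\in(\mathbb Z/4\mathbb Z)^m$ and $d\in\{\pm1\}^m$ (this includes the great diagonals). The arrangement is a most-perfect magic hypercube if it is a compact magic hypercube, every great pandiagonal also sums to the magic constant, and every pair of entries lying two apart on a great pandiagonal sums to half the magic constant. Arrangements are counted as labelings (not up to symmetry). -}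

module Defs where

open import Level using (0ℓ)
open import Data.Fin.Base using (Fin; toℕ)
open import Data.Fin.Patterns using (0F; 1F; 2F; 3F)
open import Data.Nat.Base using (ℕ; suc; _+_; _*_; _^_)
open import Data.Nat.DivMod using (_mod_)
open import Data.Product.Base using (Σ; ∃; proj₁)
open import Data.Sign.Base using (Sign)
open import Data.Vec.Base using (Vec; zipWith; _[_]≔_; sum; tabulate)
open import Function.Bundles using (_⤖_; Bijection; Inverse)
open import Relation.Binary.Bundles using (Setoid)
import Relation.Binary.Construct.On as On
open import Relation.Binary.PropositionalEquality using (_≡_; _≢_; setoid; _→-setoid_)

ℤ/4 : Set
ℤ/4 = Fin 4

infixl 6 _⊕_
infixl 7 _⊗_

_⊕_ : ℤ/4 → ℤ/4 → ℤ/4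
x ⊕ y = (toℕ x + toℕ y) mod 4

_⊗_ : ℤ/4 → ℤ/4 → ℤ/4
x ⊗ y = (toℕ x * toℕ y) mod 4

⟦_⟧ : Sign → ℤ/4
⟦ Sign.+ ⟧ = 1F
⟦ Sign.- ⟧ = 3F

Position : ℕ → Set
Position m = Vec ℤ/4 m

Arrangement : ℕ → Set
Arrangement m = Position m ⤖ Fin (4 ^ m)

index : ∀ {m} → Arrangement m → Position m → Fin (4 ^ m)
index a = Bijection.to a

-- The index k : Fin (4 ^ m) stands for the number k + 1.
entry : ∀ {m} → Arrangement m → Position m → ℕ
entry a p = suc (toℕ (index a p))

-- The point p + t d, with the direction d ∈ {±1}ᵐ given by its signs.
along : ∀ {m} → Position m → Vec Sign m → ℤ/4 → Position m
along p d t = zipWith (λ x ε → x ⊕ t ⊗ ⟦ ε ⟧) p d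

module _ {m : ℕ} (a : Arrangement m) where

  lineSum : Position m → Fin m → ℕ
  lineSum p i = sum (tabulate λ t → entry a (p [ i ]≔ t))

  subsquareSum : Position m → Fin m → Fin m → ℤ/4 → ℤ/4 → ℕ
  subsquareSum p i j x y = at x y + at (x ⊕ 1F) y + at x (y ⊕ 1F) + at (x ⊕ 1F) (y ⊕ 1F)
    where
    at : ℤ/4 → ℤ/4 → ℕ
    at u v = entry a (p [ i ]≔ u [ j ]≔ v)

  pandiagonalSum : Position m → Vec Sign m → ℕ
  pandiagonalSum p d = sum (tabulate λ t → entry a (along p d t))

  record IsCompactMagic (M : ℕ) : Set where
    field
      lines      : ∀ p i → lineSum p i ≡ M
      subsquares : ∀ p {i j} → i ≢ j → ∀ x y → subsquareSum p i j x y ≡ M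

  record IsMostPerfect (M : ℕ) : Set where
    field
      isCompactMagic : IsCompactMagic M
      pandiagonals   : ∀ p d → pandiagonalSum p d ≡ M
      -- Each such pair sums to M / 2.
      twoApart       : ∀ p d t → 2 * (entry a (along p d t) + entry a (along p d (t ⊕ 2F))) ≡ M

CompactMagicHypercube : ℕ → Set
CompactMagicHypercube m = Σ (Arrangement m) λ a → ∃ λ M → IsCompactMagic a M

MostPerfectMagicHypercube : ℕ → Set
MostPerfectMagicHypercube m = Σ (Arrangement m) λ a → ∃ λ M → IsMostPerfect a M

-- Hypercubes are identified exactly when they have the same entry at every
-- position; the bijectivity and magic-sum proofs they carry are not compared.
arrangementSetoid : ℕ → Setoid 0ℓ 0ℓ
arrangementSetoid m = On.setoid (Position m →-setoid Fin (4 ^ m)) index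

compactSetoid : ℕ → Setoid 0ℓ 0ℓ
compactSetoid m = On.setoid {B = CompactMagicHypercube m} (arrangementSetoid m) proj₁

mostPerfectSetoid : ℕ → Setoid 0ℓ 0ℓ
mostPerfectSetoid m = On.setoid {B = MostPerfectMagicHypercube m} (arrangementSetoid m) proj₁

HasCardinality : Setoid 0ℓ 0ℓ → ℕ → Set
HasCardinality S n = Inverse S (setoid (Fin n))

{-# OPTIONS --safe #-}

-- With a Gray code in each coordinate, positions become vectors ε ∈ {0,1}ⁿ, n = 2m, and the line and
-- subsquare conditions say that every four vectors differing in two given bits have the same sum of
-- entries. Equivalently, after complementing the entries at odd ε, the arrangement is affine in ε.
-- Identify ε with a vector of even parity in {0,1}ⁿ⁺¹; as n + 1 is odd, the antipodes of the even
-- vectors are the odd ones, and the arrangement extends to an affine function H on {0,1}ⁿ⁺¹ with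
-- complementary values at antipodes, which takes each value of {0, …, 2ⁿ - 1} exactly once on the even
-- vectors and once on the odd ones. Measured from a vector where H = 0, the slopes are natural
-- numbers. A second zero of H makes one slope vanish, and the other n slopes have each number below
-- 2ⁿ as exactly one subset sum, so they are 1, 2, …, 2ⁿ⁻¹ in some order. Thus an arrangement is
-- given by the omitted coordinate, the order of the others and a translation: (n + 1) · n! · 2ⁿ choices.
-- Points two apart on a pandiagonal have complementary ε; their entries are complementary exactly when
-- the omitted coordinate is the added one, which leaves n! · 2ⁿ choices.
module Submission where

open import Defs
open import Data.Nat.Base using (ℕ; _+_; _*_; _^_; _≤_; _!)
open import Data.Product.Base using (_×_)

open import Data.Bool.Base using (Bool; true; false; not; _xor_; if_then_else_)
open import Data.Bool.Properties
  using (not-involutive; not-distribˡ-xor; not-distribʳ-xor; xor-assoc; xor-comm; xor-same; xor-identityʳ; not-¬)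
open import Data.Fin.Base using (Fin; zero; suc; punchIn; punchOut; toℕ; fromℕ<; opposite)
open import Data.Fin.Patterns using (0F; 1F; 2F; 3F)
open import Data.Fin.Permutation using (permutation; reverse)
open import Data.Fin.Properties
  using (_≟_; all?; punchIn-punchOut; punchInᵢ≢i; suc-injective; toℕ<n; toℕ-fromℕ<; toℕ-injective;
         opposite-prop; 1↔⊤; 2↔Bool; *↔×)
open import Data.Nat.Base using (zero; suc; _∸_; _<_; z≤n; s≤s)
import Data.Nat.Properties as ℕ
open import Algebra.Properties.CommutativeMonoid.Sum ℕ.+-0-commutativeMonoid
  using (sum-permute; sum-cong-≗; ∑-distrib-+) renaming (sum to ∑)
open import Data.Nat.Tactic.RingSolver using (solve-∀)
open import Data.Product.Base using (∃; ∃₂; _,_; proj₁; proj₂)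
open import Data.Product.Function.NonDependent.Propositional using (_×-↔_)
open import Data.Sign.Base using (Sign)
open import Data.Unit.Base using (⊤; tt)
open import Data.Vec.Base
  using (Vec; []; _∷_; lookup; map; zipWith; replicate; insertAt; removeAt; _[_]%=_; _[_]≔_)
open import Data.Vec.Properties
  using (insertAt-lookup; removeAt-insertAt; insertAt-removeAt; lookup∘updateAt; lookup∘updateAt′; lookup-map;
         updateAt-commutes; updateAt-updateAt; updateAt-id; updateAt-cong-local)
open import Function.Base using (_∘_; id; case_of_)
open import Function.Bundles using (_↔_; mk⤖; Bijection; Inverse)
open import Function.Consequences.Propositional using (strictlySurjective⇒surjective)
open import Function.Properties.Inverse using (↔-refl; ↔-sym; ↔-trans)
open import Level using (0ℓ)
open import Relation.Binary.Bundles using (Setoid)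
open import Relation.Binary.PropositionalEquality
  using (_≡_; _≢_; refl; sym; trans; cong; cong₂; subst; module ≡-Reasoning)
open import Relation.Nullary using (yes; no; contradiction)
open import Relation.Nullary.Decidable using (from-yes)

open ≡-Reasoning

private variable
  m n : ℕ

-- Bit vectors: toggles, shifts, complement, translation and parity.

Cube : ℕ → Set
Cube n = Vec Bool n

toggle : Cube n → Fin n → Cube n
toggle x k = x [ k ]%= not

shift : Bool → Cube n → Cube n
shift c = map (c xor_)

∁ : Cube n → Cube n
∁ = map not

infixl 6 _⊻_
_⊻_ : Cube n → Cube n → Cube n
_⊻_ = zipWith _xor_

𝟎 : Cube n
𝟎 = replicate _ false

parity : Cube n → Bool
parity []      = false
parity (b ∷ x) = b xor parity x

digit : Bool → ℕ
digit false = 0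
digit true  = 1

toggle-involutive : (x : Cube n) (k : Fin n) → toggle (toggle x k) k ≡ x
toggle-involutive (b ∷ x) zero    = cong (_∷ x) (not-involutive b)
toggle-involutive (b ∷ x) (suc k) = cong (b ∷_) (toggle-involutive x k)

toggle-comm : (x : Cube n) (k l : Fin n) → toggle (toggle x k) l ≡ toggle (toggle x l) k
toggle-comm x k l with k ≟ l
... | yes refl = refl
... | no  k≢l  = updateAt-commutes l k (k≢l ∘ sym) x

parity-toggle : (x : Cube n) (k : Fin n) → parity (toggle x k) ≡ not (parity x)
parity-toggle (b ∷ x) zero    = sym (not-distribˡ-xor b (parity x))
parity-toggle (b ∷ x) (suc k) = trans (cong (b xor_) (parity-toggle x k)) (sym (not-distribʳ-xor b (parity x)))

shift-toggle : ∀ c (x : Cube n) k → shift c (toggle x k) ≡ toggle (shift c x) k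
shift-toggle c (b ∷ x) zero    = cong (_∷ shift c x) (sym (not-distribʳ-xor c b))
shift-toggle c (b ∷ x) (suc k) = cong (_ ∷_) (shift-toggle c x k)

xor-cancel : ∀ b c → b xor (b xor c) ≡ c
xor-cancel false c = refl
xor-cancel true  c = not-involutive c

shift-shift : ∀ c (x : Cube n) → shift c (shift c x) ≡ x
shift-shift c []      = refl
shift-shift c (b ∷ x) = cong₂ _∷_ (xor-cancel c b) (shift-shift c x)

∁-involutive : (x : Cube n) → ∁ (∁ x) ≡ x
∁-involutive = shift-shift true

∁-shift : ∀ c (x : Cube n) → ∁ (shift c x) ≡ shift (not c) x
∁-shift c []      = refl
∁-shift c (b ∷ x) = cong₂ _∷_ (not-distribˡ-xor c b) (∁-shift c x)

shift-not-∁ : ∀ c (x : Cube n) → shift (not c) (∁ x) ≡ shift c x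
shift-not-∁ c x = trans (sym (∁-shift c (∁ x))) (∁-shift-∁ c x)
  where
  ∁-shift-∁ : ∀ {n} c (x : Cube n) → ∁ (shift c (∁ x)) ≡ shift c x
  ∁-shift-∁ c []      = refl
  ∁-shift-∁ c (b ∷ x) = cong₂ _∷_ (trans (not-distribʳ-xor c (not b)) (cong (c xor_) (not-involutive b))) (∁-shift-∁ c x)

⊻-cancel : (x y : Cube n) → x ⊻ (x ⊻ y) ≡ y
⊻-cancel []      []      = refl
⊻-cancel (b ∷ x) (c ∷ y) = cong₂ _∷_ (xor-cancel b c) (⊻-cancel x y)

⊻-injective : (x : Cube n) {y z : Cube n} → x ⊻ y ≡ x ⊻ z → y ≡ z
⊻-injective x {y} {z} e = trans (sym (⊻-cancel x y)) (trans (cong (x ⊻_) e) (⊻-cancel x z))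

⊻-identityʳ : (x : Cube n) → x ⊻ 𝟎 ≡ x
⊻-identityʳ []      = refl
⊻-identityʳ (b ∷ x) = cong₂ _∷_ (xor-identityʳ b) (⊻-identityʳ x)

⊻-toggle : (x y : Cube n) (k : Fin n) → x ⊻ toggle y k ≡ toggle (x ⊻ y) k
⊻-toggle (b ∷ x) (c ∷ y) zero    = cong (_∷ _) (sym (not-distribʳ-xor b c))
⊻-toggle (b ∷ x) (c ∷ y) (suc k) = cong (_ ∷_) (⊻-toggle x y k)

⊻-∁ : (x y : Cube n) → x ⊻ ∁ y ≡ ∁ (x ⊻ y)
⊻-∁ []      []      = refl
⊻-∁ (b ∷ x) (c ∷ y) = cong₂ _∷_ (sym (not-distribʳ-xor b c)) (⊻-∁ x y)

-- Deleting a coordinate, and affine functions.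

data Split (i : Fin (suc n)) : Fin (suc n) → Set where
  same  : Split i i
  other : (k : Fin n) → Split i (punchIn i k)

-- Used where coordinate `i` is deleted: matching on the result settles whether `j` is that
-- coordinate and otherwise renumbers it in the smaller cube.
split : (i j : Fin (suc n)) → Split i j
split i j with i ≟ j
... | yes refl = same
... | no  i≢j  = subst (Split i) (punchIn-punchOut i≢j) (other (punchOut i≢j))

lookup-toggle : (x : Cube n) (i : Fin n) → lookup (toggle x i) i ≡ not (lookup x i)
lookup-toggle x i = lookup∘updateAt i x

lookup-toggle-punchIn : (x : Cube (suc n)) (i : Fin (suc n)) (k : Fin n) →
                        lookup (toggle x (punchIn i k)) i ≡ lookup x i
lookup-toggle-punchIn x i k = lookup∘updateAt′ i (punchIn i k) (punchInᵢ≢i i k ∘ sym) x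

removeAt-toggle : (x : Cube (suc n)) (i : Fin (suc n)) → removeAt (toggle x i) i ≡ removeAt x i
removeAt-toggle (b ∷ x)     zero    = refl
removeAt-toggle (b ∷ c ∷ x) (suc zero)    = refl
removeAt-toggle (b ∷ c ∷ d ∷ x) (suc (suc i)) = cong (b ∷_) (removeAt-toggle (c ∷ d ∷ x) (suc i))

removeAt-toggle-punchIn : (x : Cube (suc n)) (i : Fin (suc n)) (k : Fin n) →
                          removeAt (toggle x (punchIn i k)) i ≡ toggle (removeAt x i) k
removeAt-toggle-punchIn (b ∷ x)     zero    k       = refl
removeAt-toggle-punchIn (b ∷ c ∷ x) (suc i) zero    = refl
removeAt-toggle-punchIn (b ∷ c ∷ x) (suc zero) (suc k) = refl
removeAt-toggle-punchIn (b ∷ c ∷ d ∷ x) (suc (suc i)) (suc zero) = refl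
removeAt-toggle-punchIn (b ∷ c ∷ d ∷ x) (suc (suc i)) (suc (suc k)) =
  cong (b ∷_) (removeAt-toggle-punchIn (c ∷ d ∷ x) (suc i) (suc k))

removeAt-map : ∀ (f : Bool → Bool) (x : Cube (suc n)) i → removeAt (map f x) i ≡ map f (removeAt x i)
removeAt-map f (b ∷ x)     zero    = refl
removeAt-map f (b ∷ c ∷ x) (suc i) = cong (f b ∷_) (removeAt-map f (c ∷ x) i)

removeAt-⊻ : (x y : Cube (suc n)) (i : Fin (suc n)) → removeAt (x ⊻ y) i ≡ removeAt x i ⊻ removeAt y i
removeAt-⊻ (a ∷ x)     (b ∷ y)     zero    = refl
removeAt-⊻ (a ∷ c ∷ x) (b ∷ d ∷ y) (suc i) = cong (_ ∷_) (removeAt-⊻ (c ∷ x) (d ∷ y) i)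

lookup-⊻ : (x y : Cube n) (i : Fin n) → lookup (x ⊻ y) i ≡ lookup x i xor lookup y i
lookup-⊻ (a ∷ x) (b ∷ y) zero    = refl
lookup-⊻ (a ∷ x) (b ∷ y) (suc i) = lookup-⊻ x y i

removeAt-lookup-injective : (x y : Cube (suc n)) (i : Fin (suc n)) →
  lookup x i ≡ lookup y i → removeAt x i ≡ removeAt y i → x ≡ y
removeAt-lookup-injective x y i p q = begin
  x                                       ≡⟨ insertAt-removeAt x i ⟨
  insertAt (removeAt x i) i (lookup x i)  ≡⟨ cong₂ (λ u b → insertAt u i b) q p ⟩
  insertAt (removeAt y i) i (lookup y i)  ≡⟨ insertAt-removeAt y i ⟩
  y                                       ∎

-- Affinity over the integers, tested on two-dimensional faces; comparing the sums along the two
-- diagonals avoids subtraction in `ℕ`.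
Affine : (Cube n → ℕ) → Set
Affine F = ∀ x {k l} → k ≢ l → F x + F (toggle (toggle x k) l) ≡ F (toggle x k) + F (toggle x l)

-- On a face that uses coordinate `i`, both diagonals meet the same two values of `f` and the same
-- two values of `F`; on any other face the term in `f` is constant. So `f` may be arbitrary.
affine-extend : (f : Bool → ℕ) (i : Fin (suc n)) {F : Cube n → ℕ} → Affine F →
                Affine (λ x → f (lookup x i) + F (removeAt x i))
affine-extend {n} f i {F} affine x {k} {l} = go (split i k) (split i l)
  where
  G : Cube (suc n) → ℕ
  G x = f (lookup x i) + F (removeAt x i)

  a = lookup x i
  r = removeAt x i

  swap : ∀ a b c d → (a + b) + (c + d) ≡ (c + b) + (a + d)
  swap = solve-∀

  gather : ∀ a b c → (a + b) + (a + c) ≡ (a + a) + (b + c)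
  gather = solve-∀

  at : ∀ y {b s} → lookup y i ≡ b → removeAt y i ≡ s → G y ≡ f b + F s
  at y p q = cong₂ _+_ (cong f p) (cong F q)

  at-same : G (toggle x i) ≡ f (not a) + F r
  at-same = at (toggle x i) (lookup-toggle x i) (removeAt-toggle x i)

  at-other : ∀ k → G (toggle x (punchIn i k)) ≡ f a + F (toggle r k)
  at-other k = at (toggle x (punchIn i k)) (lookup-toggle-punchIn x i k) (removeAt-toggle-punchIn x i k)

  at-both : ∀ k → G (toggle (toggle x (punchIn i k)) i) ≡ f (not a) + F (toggle r k)
  at-both k = at (toggle (toggle x (punchIn i k)) i)
    (trans (lookup-toggle (toggle x (punchIn i k)) i) (cong not (lookup-toggle-punchIn x i k)))
    (trans (removeAt-toggle (toggle x (punchIn i k)) i) (removeAt-toggle-punchIn x i k))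

  at-others : ∀ k l → G (toggle (toggle x (punchIn i k)) (punchIn i l)) ≡ f a + F (toggle (toggle r k) l)
  at-others k l = at (toggle (toggle x (punchIn i k)) (punchIn i l))
    (trans (lookup-toggle-punchIn (toggle x (punchIn i k)) i l) (lookup-toggle-punchIn x i k))
    (trans (removeAt-toggle-punchIn (toggle x (punchIn i k)) i l) (cong (λ y → toggle y l) (removeAt-toggle-punchIn x i k)))

  mixed : ∀ k → G x + G (toggle (toggle x (punchIn i k)) i) ≡ G (toggle x i) + G (toggle x (punchIn i k))
  mixed k = begin
    G x + G (toggle (toggle x (punchIn i k)) i)           ≡⟨ cong (G x +_) (at-both k) ⟩
    (f a + F r) + (f (not a) + F (toggle r k))            ≡⟨ swap (f a) (F r) (f (not a)) (F (toggle r k)) ⟩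
    (f (not a) + F r) + (f a + F (toggle r k))            ≡⟨ cong₂ _+_ at-same (at-other k) ⟨
    G (toggle x i) + G (toggle x (punchIn i k))           ∎

  go : ∀ {k l} → Split i k → Split i l → k ≢ l →
       G x + G (toggle (toggle x k) l) ≡ G (toggle x k) + G (toggle x l)
  go same      same      k≢l = contradiction refl k≢l
  go same      (other l) k≢l = trans (cong (λ y → G x + G y) (toggle-comm x i _)) (mixed l)
  go (other k) same      k≢l = trans (mixed k) (ℕ.+-comm (G (toggle x i)) _)
  go (other k) (other l) k≢l = begin
    G x + G (toggle (toggle x (punchIn i k)) (punchIn i l))   ≡⟨ cong (G x +_) (at-others k l) ⟩
    (f a + F r) + (f a + F (toggle (toggle r k) l))           ≡⟨ gather (f a) (F _) (F _) ⟩
    (f a + f a) + (F r + F (toggle (toggle r k) l))           ≡⟨ cong (f a + f a +_) (affine r (k≢l ∘ cong (punchIn i))) ⟩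
    (f a + f a) + (F (toggle r k) + F (toggle r l))           ≡⟨ gather (f a) (F _) (F _) ⟨
    (f a + F (toggle r k)) + (f a + F (toggle r l))           ≡⟨ cong₂ _+_ (at-other k) (at-other l) ⟨
    G (toggle x (punchIn i k)) + G (toggle x (punchIn i l))   ∎

-- Binary numberings of the cube.

double-suc : ∀ k → suc (suc (2 * k)) ≡ 2 * suc k
double-suc = solve-∀

-- The number 2ⁿ - 1, whose n binary digits are all 1. The recursion prepends a lowest digit, as
-- `value` does.
maxValue : ℕ → ℕ
maxValue zero    = 0
maxValue (suc n) = suc (2 * maxValue n)

suc-maxValue : ∀ n → suc (maxValue n) ≡ 2 ^ n
suc-maxValue zero    = refl
suc-maxValue (suc n) = trans (double-suc (maxValue n)) (cong (2 *_) (suc-maxValue n))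

-- Assigns the binary digits, lowest first, to the coordinates; the Boolean tells whether the digit
-- is the negated coordinate.
Layout : ℕ → Set
Layout zero    = ⊤
Layout (suc n) = Fin (suc n) × Bool × Layout n

value : Layout n → Cube n → ℕ
value {zero}  _           _ = 0
value {suc n} (i , b , l) x = digit (b xor lookup x i) + 2 * value l (removeAt x i)

digit-2*-injective : ∀ b c {u v} → digit b + 2 * u ≡ digit c + 2 * v → b ≡ c × u ≡ v
digit-2*-injective false false e = refl , ℕ.*-cancelˡ-≡ _ _ 2 e
digit-2*-injective true  true  e = refl , ℕ.*-cancelˡ-≡ _ _ 2 (ℕ.suc-injective e)
digit-2*-injective false true  {u} {v} e = contradiction e (ℕ.even≢odd u v)
digit-2*-injective true  false {u} {v} e = contradiction (sym e) (ℕ.even≢odd v u)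

half : ∀ v → ∃₂ λ b u → v ≡ digit b + 2 * u
half zero    = false , 0 , refl
half (suc v) with half v
... | false , u , refl = true , u , refl
... | true  , u , refl = false , suc u , double-suc u

2*≤1+2*⇒≤ : ∀ u {v} → 2 * u ≤ suc (2 * v) → u ≤ v
2*≤1+2*⇒≤ u {v} p = ℕ.≮⇒≥ λ v<u → ℕ.n≮n _
  (ℕ.≤-trans (ℕ.≤-reflexive (double-suc v)) (ℕ.≤-trans (ℕ.*-monoʳ-≤ 2 v<u) p))

digit-not : ∀ b → digit b + digit (not b) ≡ 1
digit-not false = refl
digit-not true  = refl

-- Complementing the vector complements every binary digit, negated or not, so the two numbers add
-- up digit by digit to all ones.
value-∁ : (l : Layout n) (x : Cube n) → value l x + value l (∁ x) ≡ maxValue n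
value-∁ {zero}  _           _ = refl
value-∁ {suc n} (i , b , l) x = begin
  digit d + 2 * v + (digit (b xor lookup (∁ x) i) + 2 * value l (removeAt (∁ x) i))
    ≡⟨ cong₂ (λ c y → digit d + 2 * v + (digit c + 2 * value l y))
             (trans (cong (b xor_) (lookup-map i not x)) (sym (not-distribʳ-xor b (lookup x i))))
             (removeAt-map not x i) ⟩
  digit d + 2 * v + (digit (not d) + 2 * v′)
    ≡⟨ regroup (digit d) v (digit (not d)) v′ ⟩
  (digit d + digit (not d)) + 2 * (v + v′)
    ≡⟨ cong₂ (λ s t → s + 2 * t) (digit-not d) (value-∁ l (removeAt x i)) ⟩
  suc (2 * maxValue n) ∎
  where
  d  = b xor lookup x i
  v  = value l (removeAt x i)
  v′ = value l (∁ (removeAt x i))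

  regroup : ∀ p q r s → p + 2 * q + (r + 2 * s) ≡ (p + r) + 2 * (q + s)
  regroup = solve-∀

value-affine : (l : Layout n) → Affine (value l)
value-affine {zero}  _           x {()}
value-affine {suc n} (i , b , l) = affine-extend (λ c → digit (b xor c)) i {λ x → 2 * value l x} double
  where
  double : Affine (λ x → 2 * value l x)
  double x {k} {k′} k≢k′ = begin
    2 * value l x + 2 * value l (toggle (toggle x k) k′)    ≡⟨ ℕ.*-distribˡ-+ 2 (value l x) _ ⟨
    2 * (value l x + value l (toggle (toggle x k) k′))      ≡⟨ cong (2 *_) (value-affine l x k≢k′) ⟩
    2 * (value l (toggle x k) + value l (toggle x k′))      ≡⟨ ℕ.*-distribˡ-+ 2 (value l (toggle x k)) _ ⟩
    2 * value l (toggle x k) + 2 * value l (toggle x k′)    ∎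

value-≤ : (l : Layout n) (x : Cube n) → value l x ≤ maxValue n
value-≤ l x = ℕ.≤-trans (ℕ.m≤m+n _ _) (ℕ.≤-reflexive (value-∁ l x))

xor-injective : ∀ b {c d} → b xor c ≡ b xor d → c ≡ d
xor-injective b {c} {d} e = trans (sym (xor-cancel b c)) (trans (cong (b xor_) e) (xor-cancel b d))

value-injective : (l : Layout n) {x y : Cube n} → value l x ≡ value l y → x ≡ y
value-injective {zero}  _           {[]} {[]} _ = refl
value-injective {suc n} (i , b , l) {x}  {y}  e =
  let p , q = digit-2*-injective (b xor lookup x i) (b xor lookup y i) e
  in removeAt-lookup-injective x y i (xor-injective b p) (value-injective l q)

value-surjective : (l : Layout n) → ∀ {v} → v ≤ maxValue n → ∃ λ x → value l x ≡ v
value-surjective {zero}  _           z≤n = [] , refl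
value-surjective {suc n} (i , b , l) {v} v≤ with half v
... | d , u , refl =
  let x , e = value-surjective l (u≤ d v≤) in
  insertAt x i (b xor d) , cong₂ (λ c w → digit c + 2 * w)
    (trans (cong (b xor_) (insertAt-lookup x i _)) (xor-cancel b d))
    (trans (cong (value l) (removeAt-insertAt x i _)) e)
  where
  u≤ : ∀ d → digit d + 2 * u ≤ suc (2 * maxValue n) → u ≤ maxValue n
  u≤ true  p = 2*≤1+2*⇒≤ u (ℕ.≤-trans (ℕ.n≤1+n _) p)
  u≤ false p = 2*≤1+2*⇒≤ u p

-- A translation of the cube changes only which coordinates are negated; this operation absorbs it
-- into the layout.
_⊞_ : Layout n → Cube n → Layout n
_⊞_ {zero}  _           _ = tt
_⊞_ {suc n} (i , b , l) y = i , b xor lookup y i , l ⊞ removeAt y i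

value-⊞ : (l : Layout n) (y x : Cube n) → value (l ⊞ y) x ≡ value l (y ⊻ x)
value-⊞ {zero}  _           _ _ = refl
value-⊞ {suc n} (i , b , l) y x = cong₂ (λ c w → digit c + 2 * w)
  (trans (xor-assoc b (lookup y i) (lookup x i)) (cong (b xor_) (sym (lookup-⊻ y x i))))
  (trans (value-⊞ l (removeAt y i) (removeAt x i)) (cong (value l) (sym (removeAt-⊻ y x i))))

lookup-𝟎 : (i : Fin n) → lookup 𝟎 i ≡ false
lookup-𝟎 zero    = refl
lookup-𝟎 (suc i) = lookup-𝟎 i

-- The lowest digit is determined by the value. At `𝟎` it gives `b`, and `i` is the only coordinate
-- whose toggling changes it; the higher digits follow by recursion.
value-faithful : (l l′ : Layout n) → (∀ x → value l x ≡ value l′ x) → l ≡ l′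
value-faithful {zero}  _           _             _ = refl
value-faithful {suc n} (i , b , l) (i′ , b′ , l′) e = go b≡b′ i≡i′
  where
  lowest : ∀ x → b xor lookup x i ≡ b′ xor lookup x i′
  lowest x = proj₁ (digit-2*-injective _ _ {value l (removeAt x i)} {value l′ (removeAt x i′)} (e x))

  b≡b′ : b ≡ b′
  b≡b′ = begin
    b                        ≡⟨ xor-identityʳ b ⟨
    b xor false              ≡⟨ cong (b xor_) (lookup-𝟎 i) ⟨
    b xor lookup 𝟎 i         ≡⟨ lowest 𝟎 ⟩
    b′ xor lookup 𝟎 i′       ≡⟨ cong (b′ xor_) (lookup-𝟎 i′) ⟩
    b′ xor false             ≡⟨ xor-identityʳ b′ ⟩
    b′                       ∎

  i≡i′ : i ≡ i′
  i≡i′ with i ≟ i′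
  ... | yes p = p
  ... | no  p = contradiction (begin
    b′ xor false                        ≡⟨ cong (b′ xor_) (lookup-𝟎 i′) ⟨
    b′ xor lookup 𝟎 i′                  ≡⟨ cong (b′ xor_) (lookup∘updateAt′ i′ i (p ∘ sym) 𝟎) ⟨
    b′ xor lookup (toggle 𝟎 i) i′       ≡⟨ lowest (toggle 𝟎 i) ⟨
    b xor lookup (toggle 𝟎 i) i         ≡⟨ cong₂ _xor_ b≡b′ (trans (lookup-toggle 𝟎 i) (cong not (lookup-𝟎 i))) ⟩
    b′ xor true                         ∎) (λ q → case xor-injective b′ q of λ ())

  go : b ≡ b′ → i ≡ i′ → (i , b , l) ≡ (i′ , b′ , l′)
  go refl refl = cong (λ r → i , b , r) (value-faithful l l′ λ x → begin
    value l x                                   ≡⟨ cong (value l) (removeAt-insertAt x i false) ⟨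
    value l (removeAt (insertAt x i false) i)   ≡⟨ proj₂ (digit-2*-injective (b xor _) (b xor _) (e (insertAt x i false))) ⟩
    value l′ (removeAt (insertAt x i false) i)  ≡⟨ cong (value l′) (removeAt-insertAt x i false) ⟩
    value l′ x                                  ∎)

-- Affine functions as subset sums, and weights whose subset sums are all distinct.

toggle-induction : (P : Cube n → Set) → P 𝟎 → (∀ x k → P x → P (toggle x k)) → ∀ x → P x
toggle-induction P base step []          = base
toggle-induction P base step (false ∷ x) =
  toggle-induction (P ∘ (false ∷_)) base (λ y k → step (false ∷ y) (suc k)) x
toggle-induction P base step (true ∷ x)  = step (false ∷ x) zero
  (toggle-induction (P ∘ (false ∷_)) base (λ y k → step (false ∷ y) (suc k)) x)

weigh : Bool → ℕ → ℕ
weigh b a = if b then a else 0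

dot : Vec ℕ n → Cube n → ℕ
dot []       []      = 0
dot (a ∷ as) (b ∷ x) = weigh b a + dot as x

-- The slope in a coordinate does not depend on the other coordinates. As `F` vanishes at `𝟎`, the
-- slope is the value of `F` at a unit vector, hence a natural number.
affine⇒dot : (F : Cube n → ℕ) → F 𝟎 ≡ 0 → Affine F → ∃ λ as → ∀ x → F x ≡ dot as x
affine⇒dot {zero}  F F𝟎≡0 affine = [] , λ { [] → F𝟎≡0 }
affine⇒dot {suc n} F F𝟎≡0 affine =
  let as , e = affine⇒dot (F ∘ (false ∷_)) F𝟎≡0 (λ x k≢l → affine (false ∷ x) (k≢l ∘ suc-injective))
  in F (true ∷ 𝟎) ∷ as , λ where
       (false ∷ x) → e x
       (true ∷ x)  → trans (slope x) (cong (F (true ∷ 𝟎) +_) (e x))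
  where
  slope : ∀ x → F (true ∷ x) ≡ F (true ∷ 𝟎) + F (false ∷ x)
  slope = toggle-induction _
    (sym (trans (cong (F (true ∷ 𝟎) +_) F𝟎≡0) (ℕ.+-identityʳ _)))
    λ x k ih → ℕ.+-cancelˡ-≡ (F (false ∷ x)) _ _ (begin
      F (false ∷ x) + F (true ∷ toggle x k)                      ≡⟨ affine (false ∷ x) {zero} {suc k} (λ ()) ⟩
      F (true ∷ x) + F (false ∷ toggle x k)                      ≡⟨ cong (_+ F (false ∷ toggle x k)) ih ⟩
      F (true ∷ 𝟎) + F (false ∷ x) + F (false ∷ toggle x k)      ≡⟨ rotate (F (true ∷ 𝟎)) (F (false ∷ x)) _ ⟩
      F (false ∷ x) + (F (true ∷ 𝟎) + F (false ∷ toggle x k))    ∎)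
    where
    rotate : ∀ a b c → a + b + c ≡ b + (a + c)
    rotate = solve-∀

dot-removeAt : (as : Vec ℕ (suc n)) (x : Cube (suc n)) (i : Fin (suc n)) →
               dot as x ≡ weigh (lookup x i) (lookup as i) + dot (removeAt as i) (removeAt x i)
dot-removeAt (a ∷ as)      (b ∷ x)     zero    = refl
dot-removeAt (a ∷ a′ ∷ as) (b ∷ c ∷ x) (suc i) =
  trans (cong (weigh b a +_) (dot-removeAt (a′ ∷ as) (c ∷ x) i))
        (exchange (weigh b a) (weigh (lookup (c ∷ x) i) _) (dot (removeAt (a′ ∷ as) i) _))
  where
  exchange : ∀ p q r → p + (q + r) ≡ q + (p + r)
  exchange = solve-∀

dot-insertAt : (as : Vec ℕ (suc n)) (i : Fin (suc n)) (b : Bool) (x : Cube n) →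
               dot as (insertAt x i b) ≡ weigh b (lookup as i) + dot (removeAt as i) x
dot-insertAt as i b x = trans (dot-removeAt as (insertAt x i b) i)
  (cong₂ (λ c y → weigh c (lookup as i) + dot (removeAt as i) y) (insertAt-lookup x i b) (removeAt-insertAt x i b))

dot-𝟎 : (as : Vec ℕ n) → dot as 𝟎 ≡ 0
dot-𝟎 []       = refl
dot-𝟎 (a ∷ as) = dot-𝟎 as

dot≡1 : (as : Vec ℕ n) (x : Cube n) → dot as x ≡ 1 → ∃ λ i → lookup as i ≡ 1
dot≡1 []                   []          ()
dot≡1 (a ∷ as)             (false ∷ x) e = let i , p = dot≡1 as x e in suc i , p
dot≡1 (zero ∷ as)          (true ∷ x)  e = let i , p = dot≡1 as x e in suc i , p
dot≡1 (suc zero ∷ as)      (true ∷ x)  e = zero , refl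

dot≡0 : (as : Vec ℕ n) (x : Cube n) → dot as x ≡ 0 → ∀ i → lookup x i ≡ true → lookup as i ≡ 0
dot≡0 (a ∷ as) (true ∷ x)  e zero    _ = ℕ.m+n≡0⇒m≡0 a e
dot≡0 (a ∷ as) (b ∷ x)     e (suc i) p = dot≡0 as x (ℕ.m+n≡0⇒n≡0 (weigh b a) e) i p

dot-double : (as : Vec ℕ n) (x : Cube n) → dot (map (2 *_) as) x ≡ 2 * dot as x
dot-double []       []          = refl
dot-double (a ∷ as) (false ∷ x) = dot-double as x
dot-double (a ∷ as) (true ∷ x)  = trans (cong (2 * a +_) (dot-double as x)) (sym (ℕ.*-distribˡ-+ 2 a (dot as x)))

-- At a unit vector the subset sum is a single weight.
never-odd : (as : Vec ℕ n) → (∀ x v → dot as x ≢ suc (2 * v)) → ∃ λ bs → as ≡ map (2 *_) bs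
never-odd []       _  = [] , refl
never-odd (a ∷ as) ¬odd with half a | never-odd as (¬odd ∘ (false ∷_))
... | false , u , refl | bs , refl = u ∷ bs , refl
... | true  , u , refl | bs , refl =
  contradiction (trans (cong (suc (2 * u) +_) (dot-𝟎 (map (2 *_) bs))) (ℕ.+-identityʳ _)) (¬odd (true ∷ 𝟎) u)

-- A bijection from the cube onto the numbers from 0 to 2ⁿ - 1. The values stay in `ℕ`, so that sums
-- of them need no conversion.
record Enumerates (F : Cube n → ℕ) : Set where
  field
    injective  : ∀ {x y} → F x ≡ F y → x ≡ y
    surjective : ∀ {v} → v ≤ maxValue n → ∃ λ x → F x ≡ v
    bounded    : ∀ x → F x ≤ maxValue n

open Enumerates

-- The value 1 forces a weight equal to 1; the subset sums of the other weights are then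
-- exactly the even numbers, so these weights can be halved.
dot-enumerates : (as : Vec ℕ n) → Enumerates (dot as) → ∃ λ l → ∀ x → dot as x ≡ value l x
dot-enumerates {zero}  []  _  = tt , λ { [] → refl }
dot-enumerates {suc n} as en =
  let x , e     = surjective en (s≤s z≤n)
      i , aᵢ≡1  = dot≡1 as x e
      bs , rest = never-odd (removeAt as i) (λ x v → odd i aᵢ≡1 v x)
      l , f     = dot-enumerates bs (halved i aᵢ≡1 bs rest)
  in (i , false , l) , λ x → begin
       dot as x                                                            ≡⟨ dot-removeAt as x i ⟩
       weigh (lookup x i) (lookup as i) + dot (removeAt as i) (removeAt x i)
         ≡⟨ cong₂ _+_ (weigh-1 (lookup x i) aᵢ≡1) (doubled bs rest _) ⟩
       digit (lookup x i) + 2 * dot bs (removeAt x i)                      ≡⟨ cong (λ v → digit (lookup x i) + 2 * v) (f _) ⟩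
       digit (lookup x i) + 2 * value l (removeAt x i)                     ∎
  where
  weigh-1 : ∀ b {a} → a ≡ 1 → weigh b a ≡ digit b
  weigh-1 false _ = refl
  weigh-1 true  p = p

  doubled : ∀ bs {cs : Vec ℕ n} → cs ≡ map (2 *_) bs → ∀ x → dot cs x ≡ 2 * dot bs x
  doubled bs refl = dot-double bs

  module _ (i : Fin (suc n)) (aᵢ≡1 : lookup as i ≡ 1) where
    insert-false : ∀ x → dot as (insertAt x i false) ≡ dot (removeAt as i) x
    insert-false = dot-insertAt as i false

    insert-true : ∀ x → dot as (insertAt x i true) ≡ suc (dot (removeAt as i) x)
    insert-true x = trans (dot-insertAt as i true x) (cong (_+ dot (removeAt as i) x) aᵢ≡1)

    rest-bounded : ∀ x → dot (removeAt as i) x ≤ maxValue (suc n)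
    rest-bounded x = subst (_≤ _) (insert-false x) (bounded en (insertAt x i false))

    -- Joint recursion on `v`. If a subset with sum `2 * v` used the weight 1, the other weights
    -- would give the odd sum preceding it. If the other weights gave `suc (2 * v)`, a subset of
    -- them with sum `2 * v`, joined by the weight 1, would collide with that.
    even : ∀ v → 2 * v ≤ maxValue (suc n) → ∃ λ x → dot (removeAt as i) x ≡ 2 * v
    odd : ∀ v x → dot (removeAt as i) x ≢ suc (2 * v)

    even v 2v≤ with surjective en 2v≤
    ... | x , e with lookup x i in xᵢ | trans (sym (dot-removeAt as x i)) e
    ... | false | e′ = removeAt x i , e′
    ... | true  | e′ rewrite aᵢ≡1 with v
    ... | suc w = contradiction
      (ℕ.suc-injective (trans e′ (sym (double-suc w)))) (odd w (removeAt x i))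

    odd v x e = case insertAt-injective (injective en collision) of λ ()
      where
      below : 2 * v ≤ maxValue (suc n)
      below = ℕ.≤-trans (ℕ.n≤1+n _) (subst (_≤ _) e (rest-bounded x))

      y  = proj₁ (even v below)

      collision : dot as (insertAt x i false) ≡ dot as (insertAt y i true)
      collision = begin
        dot as (insertAt x i false)      ≡⟨ insert-false x ⟩
        dot (removeAt as i) x            ≡⟨ e ⟩
        suc (2 * v)                      ≡⟨ cong suc (proj₂ (even v below)) ⟨
        suc (dot (removeAt as i) y)      ≡⟨ insert-true y ⟨
        dot as (insertAt y i true)       ∎

      insertAt-injective : ∀ {b c} → insertAt x i b ≡ insertAt y i c → b ≡ c
      insertAt-injective {b} {c} p =
        trans (sym (insertAt-lookup x i b)) (trans (cong (λ z → lookup z i) p) (insertAt-lookup y i c))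

    halved : ∀ bs → removeAt as i ≡ map (2 *_) bs → Enumerates (dot bs)
    halved bs rest = record
      { injective  = λ {x} {y} e → insertAt-cancel x y (injective en (begin
          dot as (insertAt x i false)   ≡⟨ insert-false x ⟩
          dot (removeAt as i) x         ≡⟨ doubled bs rest x ⟩
          2 * dot bs x                  ≡⟨ cong (2 *_) e ⟩
          2 * dot bs y                  ≡⟨ doubled bs rest y ⟨
          dot (removeAt as i) y         ≡⟨ insert-false y ⟨
          dot as (insertAt y i false)   ∎))
      ; surjective = λ {v} v≤ →
          let x , e = even v (ℕ.≤-trans (ℕ.*-monoʳ-≤ 2 v≤) (ℕ.n≤1+n _))
          in x , ℕ.*-cancelˡ-≡ _ _ 2 (trans (sym (doubled bs rest x)) e)
      ; bounded    = λ x → 2*≤1+2*⇒≤ (dot bs x) (subst (_≤ _) (doubled bs rest x) (rest-bounded x))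
      }
      where
      insertAt-cancel : ∀ x y → insertAt x i false ≡ insertAt y i false → x ≡ y
      insertAt-cancel x y p =
        trans (sym (removeAt-insertAt x i false)) (trans (cong (λ z → removeAt z i) p) (removeAt-insertAt y i false))

-- Vectors of even parity in the cube with one more coordinate.

parity-shift : ∀ m c (x : Cube (m * 2)) → parity (shift c x) ≡ parity x
parity-shift zero    c []          = refl
-- The even length matters: coordinates are taken in pairs, and flipping both of a pair keeps the
-- parity.
parity-shift (suc m) c (a ∷ b ∷ x) = begin
  (c xor a) xor ((c xor b) xor parity (shift c x))   ≡⟨ cong (λ p → (c xor a) xor ((c xor b) xor p)) (parity-shift m c x) ⟩
  (c xor a) xor ((c xor b) xor parity x)             ≡⟨ cancel c a b (parity x) ⟩
  a xor (b xor parity x)                             ∎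
  where
  cancel : ∀ c a b p → (c xor a) xor ((c xor b) xor p) ≡ a xor (b xor p)
  cancel false a     b p = refl
  cancel true  false b p = trans (cong not (sym (not-distribˡ-xor b p))) (not-involutive (b xor p))
  cancel true  true  b p = sym (not-distribˡ-xor b p)

parity-⊻ : (x y : Cube n) → parity (x ⊻ y) ≡ parity x xor parity y
parity-⊻ []      []      = refl
parity-⊻ (a ∷ x) (b ∷ y) = trans (cong ((a xor b) xor_) (parity-⊻ x y)) (interchange a b (parity x) (parity y))
  where
  interchange : ∀ a b p q → (a xor b) xor (p xor q) ≡ (a xor p) xor (b xor q)
  interchange a b p q = begin
    (a xor b) xor (p xor q)   ≡⟨ xor-assoc a b (p xor q) ⟩
    a xor (b xor (p xor q))   ≡⟨ cong (a xor_) (xor-assoc b p q) ⟨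
    a xor ((b xor p) xor q)   ≡⟨ cong (λ r → a xor (r xor q)) (xor-comm b p) ⟩
    a xor ((p xor b) xor q)   ≡⟨ cong (a xor_) (xor-assoc p b q) ⟩
    a xor (p xor (b xor q))   ≡⟨ xor-assoc a p (b xor q) ⟨
    (a xor p) xor (b xor q)   ∎

parity-removeAt : (z : Cube (suc n)) (i : Fin (suc n)) → parity z ≡ lookup z i xor parity (removeAt z i)
parity-removeAt (b ∷ z)     zero    = refl
parity-removeAt (b ∷ c ∷ z) (suc i) = begin
  b xor parity (c ∷ z)                              ≡⟨ cong (b xor_) (parity-removeAt (c ∷ z) i) ⟩
  b xor (d xor parity (removeAt (c ∷ z) i))         ≡⟨ xor-assoc b d _ ⟨
  (b xor d) xor parity (removeAt (c ∷ z) i)         ≡⟨ cong (_xor parity (removeAt (c ∷ z) i)) (xor-comm b d) ⟩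
  (d xor b) xor parity (removeAt (c ∷ z) i)         ≡⟨ xor-assoc d b _ ⟩
  d xor (b xor parity (removeAt (c ∷ z) i))         ∎
  where d = lookup (c ∷ z) i

odd⇒nonzero : (x : Cube n) → parity x ≡ true → ∃ λ i → lookup x i ≡ true
odd⇒nonzero (true ∷ x)  _ = zero , refl
odd⇒nonzero (false ∷ x) p = let i , q = odd⇒nonzero x p in suc i , q

-- The inserted parity bit makes this the even vector from which deleting coordinate `i` leaves `u`.
-- Thus deletion of any coordinate is invertible on even vectors.
fill : Fin (suc n) → Cube n → Cube (suc n)
fill i u = insertAt u i (parity u)

removeAt-fill : (i : Fin (suc n)) (u : Cube n) → removeAt (fill i u) i ≡ u
removeAt-fill i u = removeAt-insertAt u i (parity u)

parity-fill : (i : Fin (suc n)) (u : Cube n) → parity (fill i u) ≡ false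
parity-fill i u = begin
  parity (fill i u)                                         ≡⟨ parity-removeAt (fill i u) i ⟩
  lookup (fill i u) i xor parity (removeAt (fill i u) i)
    ≡⟨ cong₂ (λ b v → b xor parity v) (insertAt-lookup u i _) (removeAt-fill i u) ⟩
  parity u xor parity u                                     ≡⟨ xor-same (parity u) ⟩
  false                                                     ∎

parity-removeAt-injective : (z w : Cube (suc n)) (i : Fin (suc n)) →
                            parity z ≡ parity w → removeAt z i ≡ removeAt w i → z ≡ w
parity-removeAt-injective z w i p q = removeAt-lookup-injective z w i (xor-injective r (begin
  r xor lookup z i                        ≡⟨ xor-comm r (lookup z i) ⟩
  lookup z i xor r                        ≡⟨ parity-removeAt z i ⟨
  parity z                                ≡⟨ p ⟩
  parity w                                ≡⟨ parity-removeAt w i ⟩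
  lookup w i xor parity (removeAt w i)    ≡⟨ cong (λ v → lookup w i xor parity v) q ⟨
  lookup w i xor r                        ≡⟨ xor-comm (lookup w i) r ⟩
  r xor lookup w i                        ∎)) q
  where r = parity (removeAt z i)

-- For even n, lift is a bijection from the n-cube to the vectors of even parity in the
-- (n + 1)-cube, with inverse drop.
lift : Cube n → Cube (suc n)
lift x = parity x ∷ shift (parity x) x

drop : Cube (suc n) → Cube n
drop (c ∷ x) = shift c x

drop-lift : (x : Cube n) → drop (lift x) ≡ x
drop-lift x = shift-shift (parity x) x

-- Complementing the leading bit undoes the complement of the rest, so `drop` identifies antipodes.
-- It can therefore carry a function on the small cube to odd vectors as well.
drop-∁ : (z : Cube (suc n)) → drop (∁ z) ≡ drop z
drop-∁ (c ∷ x) = shift-not-∁ c x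

-- Toggling one bit flips the parity, hence the leading bit and the shift of all the others.
lift-toggle : (x : Cube n) (k : Fin n) → lift (toggle x k) ≡ ∁ (toggle (lift x) (suc k))
lift-toggle x k rewrite parity-toggle x k = cong (not (parity x) ∷_) (begin
  shift (not (parity x)) (toggle x k)      ≡⟨ ∁-shift (parity x) (toggle x k) ⟨
  ∁ (shift (parity x) (toggle x k))        ≡⟨ cong ∁ (shift-toggle (parity x) x k) ⟩
  ∁ (toggle (shift (parity x) x) k)        ∎)

parity-∁ : ∀ m (z : Cube (suc (m * 2))) → parity (∁ z) ≡ not (parity z)
parity-∁ m (c ∷ x) = trans (cong (not c xor_) (parity-shift m true x)) (sym (not-distribˡ-xor c (parity x)))

parity-lift : ∀ m (x : Cube (m * 2)) → parity (lift x) ≡ false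
parity-lift m x = trans (cong (parity x xor_) (parity-shift m (parity x) x)) (xor-same (parity x))

lift-drop : ∀ m (z : Cube (suc (m * 2))) → parity z ≡ false → lift (drop z) ≡ z
lift-drop m (c ∷ x) even = begin
  parity (shift c x) ∷ shift (parity (shift c x)) (shift c x)
    ≡⟨ cong (λ b → b ∷ shift b (shift c x)) (trans (parity-shift m c x) (sym c≡)) ⟩
  c ∷ shift c (shift c x)                                      ≡⟨ cong (c ∷_) (shift-shift c x) ⟩
  c ∷ x                                                        ∎
  where
  c≡ : c ≡ parity x
  c≡ = xor-injective (parity x) (trans (xor-comm (parity x) c) (trans even (sym (xor-same (parity x)))))

-- In even length the complement keeps the parity. So antipodes in the small cube become even
-- vectors that agree in the added coordinate and differ in all others, which is what distinguishes
-- code index `zero`.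
lift-∁ : ∀ m (x : Cube (m * 2)) → lift (∁ x) ≡ parity x ∷ ∁ (shift (parity x) x)
lift-∁ m x rewrite parity-shift m true x = cong (parity x ∷_) (shift-∁ (parity x) x)
  where
  shift-∁ : ∀ c (x : Cube n) → shift c (∁ x) ≡ ∁ (shift c x)
  shift-∁ c []      = refl
  shift-∁ c (b ∷ x) = cong₂ _∷_ (sym (not-distribʳ-xor c b)) (shift-∁ c x)

-- Codes and the numberings they encode.

Code : ℕ → Set
Code n = Fin (suc n) × Layout n

evaluate : Code n → Cube (suc n) → ℕ
evaluate (k , l) z = value l (removeAt z k)

encode : Code n → Cube n → ℕ
encode c x = evaluate c (lift x)

evaluate-∁ : (c : Code n) (z : Cube (suc n)) → evaluate c z + evaluate c (∁ z) ≡ maxValue n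
evaluate-∁ (k , l) z = trans
  (cong (λ y → value l (removeAt z k) + value l y) (removeAt-map not z k))
  (value-∁ l (removeAt z k))

evaluate-affine : (c : Code n) → Affine (evaluate c)
evaluate-affine (k , l) = affine-extend (λ _ → 0) k {value l} (value-affine l)

-- The common form of the line and subsquare conditions in Gray code bits, with entries counted from
-- 0: on average each of the four is half of `maxValue n`.
Balanced : (Cube n → ℕ) → Set
Balanced {n} G = ∀ x {k l} → k ≢ l →
  G x + G (toggle x k) + (G (toggle x l) + G (toggle (toggle x k) l)) ≡ 2 * maxValue n

-- By `lift-toggle`, a face becomes one diagonal of a face in the larger cube together with the
-- antipodes of the other diagonal. Affinity trades the first diagonal for the second, leaving two
-- antipodal pairs, each with sum `maxValue n`.
encode-balanced : (c : Code n) → Balanced (encode c)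
encode-balanced {n} c x {k} {l} k≢l = begin
  E z + encode c (toggle x k) + (encode c (toggle x l) + encode c (toggle (toggle x k) l))
    ≡⟨ cong₂ (λ u v → E z + E u + (E v + encode c (toggle (toggle x k) l))) (lift-toggle x k) (lift-toggle x l) ⟩
  E z + E (∁ (toggle z k′)) + (E (∁ (toggle z l′)) + encode c (toggle (toggle x k) l))
    ≡⟨ cong (λ u → E z + E (∁ (toggle z k′)) + (E (∁ (toggle z l′)) + E u)) lift-toggle² ⟩
  E z + E (∁ (toggle z k′)) + (E (∁ (toggle z l′)) + E (toggle (toggle z k′) l′))
    ≡⟨ regroup₁ (E z) _ _ _ ⟩
  (E z + E (toggle (toggle z k′) l′)) + (E (∁ (toggle z k′)) + E (∁ (toggle z l′)))
    ≡⟨ cong (_+ (E (∁ (toggle z k′)) + E (∁ (toggle z l′)))) (evaluate-affine c z (k≢l ∘ suc-injective)) ⟩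
  (E (toggle z k′) + E (toggle z l′)) + (E (∁ (toggle z k′)) + E (∁ (toggle z l′)))
    ≡⟨ regroup₂ (E (toggle z k′)) (E (toggle z l′)) (E (∁ (toggle z k′))) (E (∁ (toggle z l′))) ⟩
  (E (toggle z k′) + E (∁ (toggle z k′))) + (E (toggle z l′) + E (∁ (toggle z l′)) + 0)
    ≡⟨ cong₂ (λ u v → u + (v + 0)) (evaluate-∁ c (toggle z k′)) (evaluate-∁ c (toggle z l′)) ⟩
  2 * maxValue n ∎
  where
  E  = evaluate c
  z  = lift x
  k′ = suc k
  l′ = suc l

  lift-toggle² : lift (toggle (toggle x k) l) ≡ toggle (toggle z k′) l′
  lift-toggle² = begin
    lift (toggle (toggle x k) l)          ≡⟨ lift-toggle (toggle x k) l ⟩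
    ∁ (toggle (lift (toggle x k)) l′)     ≡⟨ cong (λ w → ∁ (toggle w l′)) (lift-toggle x k) ⟩
    ∁ (toggle (∁ (toggle z k′)) l′)       ≡⟨ shift-toggle true (∁ (toggle z k′)) l′ ⟩
    toggle (∁ (∁ (toggle z k′))) l′       ≡⟨ cong (λ w → toggle w l′) (∁-involutive (toggle z k′)) ⟩
    toggle (toggle z k′) l′               ∎

  regroup₁ : ∀ a b c d → a + b + (c + d) ≡ (a + d) + (b + c)
  regroup₁ = solve-∀

  regroup₂ : ∀ a b c d → (a + b) + (c + d) ≡ (a + c) + (b + d + 0)
  regroup₂ = solve-∀

-- The coordinates of an even vector other than `k` can be prescribed freely and determine it, so
-- deleting `k` maps the image of `lift` bijectively onto the small cube, where `value` enumerates.
encode-enumerates : ∀ m (c : Code (m * 2)) → Enumerates (encode c)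
encode-enumerates m (k , l) = record
  { injective  = λ {x} {y} e → begin
      x              ≡⟨ drop-lift x ⟨
      drop (lift x)  ≡⟨ cong drop (parity-removeAt-injective (lift x) (lift y) k
                          (trans (parity-lift m x) (sym (parity-lift m y))) (value-injective l e)) ⟩
      drop (lift y)  ≡⟨ drop-lift y ⟩
      y              ∎
  ; surjective = λ v≤ →
      let u , e = value-surjective l v≤
      in drop (fill k u) ,
         trans (cong (λ z → value l (removeAt z k)) (lift-drop m (fill k u) (parity-fill k u)))
               (trans (cong (value l) (removeAt-fill k u)) e)
  ; bounded    = λ x → value-≤ l (removeAt (lift x) k)
  }

-- The self-dual extension, and reading a code off its numbering.

complement-if : Bool → ℕ → ℕ → ℕ
complement-if b K v = if b then K ∸ v else v

complement-if-≤ : ∀ b {K v} → v ≤ K → complement-if b K v ≤ K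
complement-if-≤ false v≤ = v≤
complement-if-≤ true  {K} {v} _ = ℕ.m∸n≤m K v

complement-if-not : ∀ b {K v} → v ≤ K → complement-if (not b) K v ≡ K ∸ complement-if b K v
complement-if-not false _  = refl
complement-if-not true  v≤ = sym (ℕ.m∸[m∸n]≡n v≤)

-- Vertices of a face have equal parity exactly when they lie on one diagonal. So complementing the
-- values at odd vertices turns the sum `2 * K` over the face into equality of the two diagonal
-- sums.
complement-if-balanced : ∀ b {K p q r s} → p ≤ K → q ≤ K → r ≤ K → s ≤ K → p + q + (r + s) ≡ 2 * K →
  complement-if b K p + complement-if b K s ≡ complement-if (not b) K q + complement-if (not b) K r
complement-if-balanced true  {K} {p} {q} {r} {s} p≤ q≤ r≤ s≤ e =
  sym (complement-if-balanced false {K} {q} {p} {s} {r} q≤ p≤ s≤ r≤ (trans (swap q p s r) e))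
  where
  swap : ∀ q p s r → q + p + (s + r) ≡ p + q + (r + s)
  swap = solve-∀
complement-if-balanced false {K} {p} {q} {r} {s} p≤ q≤ r≤ s≤ e = ℕ.+-cancelʳ-≡ (q + r) _ _ (begin
  p + s + (q + r)                 ≡⟨ regroup₁ p q r s ⟩
  p + q + (r + s)                 ≡⟨ e ⟩
  K + (K + 0)                     ≡⟨ cong₂ (λ u v → u + (v + 0)) (ℕ.m∸n+n≡m q≤) (ℕ.m∸n+n≡m r≤) ⟨
  K ∸ q + q + (K ∸ r + r + 0)     ≡⟨ regroup₂ (K ∸ q) q (K ∸ r) r ⟩
  K ∸ q + (K ∸ r) + (q + r)       ∎)
  where
  regroup₁ : ∀ p q r s → p + s + (q + r) ≡ p + q + (r + s)
  regroup₁ = solve-∀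

  regroup₂ : ∀ a q b r → a + q + (b + r + 0) ≡ a + b + (q + r)
  regroup₂ = solve-∀

-- The extension of G ∘ drop from the even to the odd vectors with extend (∁ z) = max ∸ extend z.
extend : (Cube n → ℕ) → Cube (suc n) → ℕ
extend {n} G z = complement-if (parity z) (maxValue n) (G (drop z))

extend-lift : ∀ m (G : Cube (m * 2) → ℕ) x → extend G (lift x) ≡ G x
extend-lift m G x = cong₂ (λ b y → complement-if b _ (G y)) (parity-lift m x) (drop-lift x)

-- At even vectors `lift` undoes `drop`. At odd ones both sides are the complement of their value at
-- the antipode, which is even.
extend-encode : ∀ m (c : Code (m * 2)) z → extend (encode c) z ≡ evaluate c z
extend-encode m c z with parity z in p
... | false = cong (evaluate c) (lift-drop m z p)
... | true  = begin
  K ∸ evaluate c (lift (drop z))                       ≡⟨ cong (λ y → K ∸ evaluate c (lift y)) (drop-∁ z) ⟨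
  K ∸ evaluate c (lift (drop (∁ z)))
    ≡⟨ cong (λ w → K ∸ evaluate c w) (lift-drop m (∁ z) (trans (parity-∁ m z) (cong not p))) ⟩
  K ∸ evaluate c (∁ z)                                 ≡⟨ cong (_∸ evaluate c (∁ z)) (evaluate-∁ c z) ⟨
  evaluate c z + evaluate c (∁ z) ∸ evaluate c (∁ z)   ≡⟨ ℕ.m+n∸n≡m (evaluate c z) (evaluate c (∁ z)) ⟩
  evaluate c z                                         ∎
  where K = maxValue (m * 2)

-- Equal encodings have equal extensions, so the codes agree on the whole larger cube, where first
-- the ignored coordinate and then the layout can be read off.
encode-injective : ∀ m (c d : Code (m * 2)) → (∀ x → encode c x ≡ encode d x) → c ≡ d
encode-injective m c@(k , l) d@(k′ , l′) e = go k≡k′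
  where
  agree : ∀ z → evaluate c z ≡ evaluate d z
  agree z = trans (sym (extend-encode m c z))
    (trans (cong (complement-if (parity z) _) (e (drop z))) (extend-encode m d z))

  -- Coordinate k is the only one that evaluate c ignores.
  k≡k′ : k ≡ k′
  k≡k′ with split k′ k
  ... | same    = refl
  ... | other j = contradiction (value-injective l′ (begin
    value l′ (toggle (removeAt 𝟎 k′) j)               ≡⟨ cong (value l′) (removeAt-toggle-punchIn 𝟎 k′ j) ⟨
    evaluate d (toggle 𝟎 k)                           ≡⟨ agree (toggle 𝟎 k) ⟨
    evaluate c (toggle 𝟎 k)                           ≡⟨ cong (value l) (removeAt-toggle 𝟎 k) ⟩
    evaluate c 𝟎                                      ≡⟨ agree 𝟎 ⟩
    value l′ (removeAt 𝟎 k′)                          ∎)) (toggle-≢ (removeAt 𝟎 k′) j)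
    where
    toggle-≢ : (x : Cube n) (k : Fin n) → toggle x k ≢ x
    toggle-≢ x k p = not-¬ refl (trans (sym (cong (λ y → lookup y k) p)) (lookup-toggle x k))

  go : k ≡ k′ → c ≡ d
  go refl = cong (k ,_) (value-faithful l l′ λ x → begin
    value l x                               ≡⟨ cong (value l) (removeAt-fill k x) ⟨
    evaluate c (fill k x)                   ≡⟨ agree (fill k x) ⟩
    evaluate d (fill k x)                   ≡⟨ cong (value l′) (removeAt-fill k x) ⟩
    value l′ x                              ∎)

encode-zero-∁ : ∀ m l (x : Cube (m * 2)) → encode (zero , l) x + encode (zero , l) (∁ x) ≡ maxValue (m * 2)
encode-zero-∁ m l x = trans
  (cong (λ z → value l (shift (parity x) x) + value l (removeAt z zero)) (lift-∁ m x))
  (value-∁ l (shift (parity x) x))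

-- The hypothesis gives `lift (∁ x)` the same value as `∁ (lift x)`. These vectors differ only in
-- the added coordinate, so injectivity of `value` would fail if that coordinate were not the
-- ignored one.
encode-∁⇒zero : ∀ m k l (x : Cube (m * 2)) →
  encode (k , l) x + encode (k , l) (∁ x) ≡ maxValue (m * 2) → k ≡ zero
encode-∁⇒zero m       zero    l x e = refl
encode-∁⇒zero (suc m) (suc k) l x e = contradiction
  (trans (head-removeAt (not p) y) (trans
    (cong (λ u → lookup u zero)
          (value-injective l {removeAt (not p ∷ y) (suc k)} {removeAt (p ∷ y) (suc k)} clash))
    (sym (head-removeAt p y))))
  (not-¬ refl ∘ sym)
  where
  p = parity x
  y = ∁ (shift p x)
  z = lift x

  head-removeAt : ∀ b y → b ≡ lookup (removeAt (b ∷ y) (suc k)) zero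
  head-removeAt b (_ ∷ _) = refl

  clash : evaluate (suc k , l) (not p ∷ y) ≡ evaluate (suc k , l) (p ∷ y)
  clash = ℕ.+-cancelˡ-≡ (evaluate (suc k , l) z) _ _ (begin
    evaluate (suc k , l) z + evaluate (suc k , l) (∁ z)           ≡⟨ evaluate-∁ (suc k , l) z ⟩
    maxValue (suc m * 2)                                          ≡⟨ e ⟨
    evaluate (suc k , l) z + evaluate (suc k , l) (lift (∁ x))
      ≡⟨ cong (λ w → evaluate (suc k , l) z + evaluate (suc k , l) w) (lift-∁ (suc m) x) ⟩
    evaluate (suc k , l) z + evaluate (suc k , l) (p ∷ y)         ∎)

-- Every balanced enumeration comes from a code.

dot-∁ : (as : Vec ℕ n) (x : Cube n) → dot as x + dot as (∁ x) ≡ dot as (∁ 𝟎)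
dot-∁ []       []          = refl
dot-∁ (a ∷ as) (false ∷ x) = trans (exchange (dot as x) a (dot as (∁ x))) (cong (a +_) (dot-∁ as x))
  where
  exchange : ∀ p q r → p + (q + r) ≡ q + (p + r)
  exchange = solve-∀
dot-∁ (a ∷ as) (true ∷ x)  = trans (ℕ.+-assoc a (dot as x) (dot as (∁ x))) (cong (a +_) (dot-∁ as x))

-- Affinity on the half with leading bit `false` yields all weights but the first, and self-duality
-- determines the other half. The first weight is `K ∸ total`, a true difference because `total` is
-- itself a value of `F`.
self-dual⇒dot : ∀ K (F : Cube (suc n) → ℕ) → F 𝟎 ≡ 0 → Affine (F ∘ (false ∷_)) →
                (∀ z → F (∁ z) ≡ K ∸ F z) → (∀ z → F z ≤ K) → ∃ λ as → ∀ z → F z ≡ dot as z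
self-dual⇒dot {n} K F F𝟎≡0 affine dual F≤ with affine⇒dot (F ∘ (false ∷_)) F𝟎≡0 affine
... | as , e = (K ∸ total) ∷ as , λ where
      (false ∷ x) → e x
      (true ∷ x)  → begin
        F (true ∷ x)                                              ≡⟨ cong (F ∘ (true ∷_)) (∁-involutive x) ⟨
        F (∁ (false ∷ ∁ x))                                       ≡⟨ dual (false ∷ ∁ x) ⟩
        K ∸ F (false ∷ ∁ x)                                       ≡⟨ cong (K ∸_) (e (∁ x)) ⟩
        K ∸ dot as (∁ x)                                          ≡⟨ cong (_∸ dot as (∁ x)) (ℕ.m∸n+n≡m total≤) ⟨
        K ∸ total + total ∸ dot as (∁ x)                          ≡⟨ cong (λ t → K ∸ total + t ∸ dot as (∁ x)) (dot-∁ as x) ⟨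
        K ∸ total + (dot as x + dot as (∁ x)) ∸ dot as (∁ x)      ≡⟨ cong (_∸ dot as (∁ x)) (ℕ.+-assoc (K ∸ total) _ _) ⟨
        K ∸ total + dot as x + dot as (∁ x) ∸ dot as (∁ x)        ≡⟨ ℕ.m+n∸n≡m (K ∸ total + dot as x) (dot as (∁ x)) ⟩
        K ∸ total + dot as x                                      ∎
  where
  total : ℕ
  total = dot as (∁ 𝟎)

  total≤ : total ≤ K
  total≤ = subst (_≤ K) (e (∁ 𝟎)) (F≤ (false ∷ ∁ 𝟎))

module _ (m : ℕ) (G : Cube (m * 2) → ℕ) (en : Enumerates G) (balanced : Balanced G) where
  private
    K : ℕ
    K = maxValue (m * 2)

    E : Cube (suc (m * 2)) → ℕ
    E = extend G

    E≤ : ∀ z → E z ≤ K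
    E≤ z = complement-if-≤ (parity z) (bounded en (drop z))

    E-∁ : ∀ z → E (∁ z) ≡ K ∸ E z
    E-∁ z = trans (cong₂ (λ b y → complement-if b K (G y)) (parity-∁ m z) (drop-∁ z))
                  (complement-if-not (parity z) (bounded en (drop z)))

    -- Within the half with leading bit `c`, `drop` is a fixed shift, so faces go to faces and
    -- `complement-if-balanced` applies. The remaining direction is covered by self-duality.
    E-affine : ∀ c → Affine (E ∘ (c ∷_))
    E-affine c x {k} {l} k≢l = begin
      E (c ∷ x) + E (c ∷ toggle (toggle x k) l)
        ≡⟨ cong (E (c ∷ x) +_) (at (toggle (toggle x k) l)
             (trans (parity-toggle (toggle x k) l) (trans (cong not (parity-toggle x k)) (not-involutive (parity x))))
             (trans (shift-toggle c (toggle x k) l) (cong (λ y → toggle y l) (shift-toggle c x k)))) ⟩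
      complement-if b K (G y) + complement-if b K (G (toggle (toggle y k) l))
        ≡⟨ complement-if-balanced b (bounded en y) (bounded en (toggle y k)) (bounded en (toggle y l))
             (bounded en (toggle (toggle y k) l)) (balanced y k≢l) ⟩
      complement-if (not b) K (G (toggle y k)) + complement-if (not b) K (G (toggle y l))
        ≡⟨ cong₂ _+_ (at-toggle k) (at-toggle l) ⟨
      E (c ∷ toggle x k) + E (c ∷ toggle x l) ∎
      where
      b = c xor parity x
      y = shift c x

      at : ∀ w {p u} → parity w ≡ p → shift c w ≡ u → E (c ∷ w) ≡ complement-if (c xor p) K (G u)
      at w refl refl = refl

      at-toggle : ∀ k → E (c ∷ toggle x k) ≡ complement-if (not b) K (G (toggle y k))
      at-toggle k = trans (at (toggle x k) (parity-toggle x k) (shift-toggle c x k))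
        (cong (λ d → complement-if d K (G (toggle y k))) (sym (not-distribʳ-xor c (parity x))))

    even-injective : ∀ {z w} → parity z ≡ false → parity w ≡ false → E z ≡ E w → z ≡ w
    even-injective {z} {w} p q e = begin
      z              ≡⟨ lift-drop m z p ⟨
      lift (drop z)  ≡⟨ cong lift (injective en (trans (sym (at z p)) (trans e (at w q)))) ⟩
      lift (drop w)  ≡⟨ lift-drop m w q ⟩
      w              ∎
      where
      at : ∀ z → parity z ≡ false → E z ≡ G (drop z)
      at z p = cong (λ b → complement-if b K (G (drop z))) p

    base : Cube (m * 2)
    base = proj₁ (surjective en z≤n)

    origin : Cube (suc (m * 2))
    origin = lift base

    -- Moving a zero of `E` to `𝟎` makes the slopes natural numbers, as `self-dual⇒dot` requires.
    F : Cube (suc (m * 2)) → ℕ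
    F y = E (origin ⊻ y)

    F-translate : ∀ z → F (origin ⊻ z) ≡ E z
    F-translate z = cong E (⊻-cancel origin z)

    F-𝟎 : F 𝟎 ≡ 0
    F-𝟎 = trans (cong E (⊻-identityʳ origin)) (trans (extend-lift m G base) (proj₂ (surjective en z≤n)))

    F-affine : Affine (F ∘ (false ∷_))
    F-affine x {k} {l} k≢l = begin
      F (false ∷ x) + F (false ∷ toggle (toggle x k) l)     ≡⟨ cong (λ u → F (false ∷ x) + H u) translate² ⟩
      H y + H (toggle (toggle y k) l)                       ≡⟨ E-affine (p xor false) y k≢l ⟩
      H (toggle y k) + H (toggle y l)                       ≡⟨ cong₂ (λ u v → H u + H v) (⊻-toggle t x k) (⊻-toggle t x l) ⟨
      F (false ∷ toggle x k) + F (false ∷ toggle x l)       ∎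
      where
      p = parity base
      t = shift p base
      y = t ⊻ x

      H : Cube (m * 2) → ℕ
      -- The term `p xor false` is the leading bit of `origin ⊻ (false ∷ x)` as it computes; it does
      -- not reduce to `p`.
      H = E ∘ ((p xor false) ∷_)

      translate² : t ⊻ toggle (toggle x k) l ≡ toggle (toggle y k) l
      translate² = trans (⊻-toggle t (toggle x k) l) (cong (λ u → toggle u l) (⊻-toggle t x k))

    weights : ∃ λ as → ∀ y → F y ≡ dot as y
    weights = self-dual⇒dot K F F-𝟎 F-affine (λ y → trans (cong E (⊻-∁ origin y)) (E-∁ (origin ⊻ y))) (λ y → E≤ (origin ⊻ y))

    as : Vec ℕ (suc (m * 2))
    as = proj₁ weights

    parity-translate : ∀ y → parity (origin ⊻ y) ≡ parity y
    parity-translate y = trans (parity-⊻ origin y) (cong (_xor parity y) (parity-lift m base))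

    -- The value 0 is also taken at an odd vector, hence at a nonzero difference from the origin.
    zero-weight : ∃ λ k → lookup as k ≡ 0
    zero-weight =
      let x , Gx≡K = surjective en ℕ.≤-refl
          z        = ∁ (lift x)
          y        = origin ⊻ z
          Fy≡0     = begin
            F y            ≡⟨ F-translate z ⟩
            E z            ≡⟨ E-∁ (lift x) ⟩
            K ∸ E (lift x) ≡⟨ cong (K ∸_) (trans (extend-lift m G x) Gx≡K) ⟩
            K ∸ K          ≡⟨ ℕ.n∸n≡0 K ⟩
            0              ∎
          odd      = trans (parity-translate z) (trans (parity-∁ m (lift x)) (cong not (parity-lift m x)))
          k , yₖ   = odd⇒nonzero y odd
      in k , dot≡0 as y (trans (sym (proj₂ weights y)) Fy≡0) k yₖ

    k : Fin (suc (m * 2))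
    k = proj₁ zero-weight

    bs : Vec ℕ (m * 2)
    bs = removeAt as k

    F-removeAt : ∀ y → F y ≡ dot bs (removeAt y k)
    F-removeAt y = begin
      F y                                                             ≡⟨ proj₂ weights y ⟩
      dot as y                                                        ≡⟨ dot-removeAt as y k ⟩
      weigh (lookup y k) (lookup as k) + dot bs (removeAt y k)
        ≡⟨ cong (_+ dot bs (removeAt y k)) (weigh-0 (lookup y k) (proj₂ zero-weight)) ⟩
      dot bs (removeAt y k)                                           ∎
      where
      weigh-0 : ∀ b {a} → a ≡ 0 → weigh b a ≡ 0
      weigh-0 false _ = refl
      weigh-0 true  p = p

    F-fill : ∀ u → F (fill k u) ≡ dot bs u
    F-fill u = trans (F-removeAt (fill k u)) (cong (dot bs) (removeAt-fill k u))

    -- Since `origin` is even, translation by it permutes the even vectors, on which `E` takes each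
    -- value once. The weight at `k` being 0, deleting `k` keeps the value and is invertible on even
    -- vectors.
    bs-enumerates : Enumerates (dot bs)
    bs-enumerates = record
      { injective  = λ {u} {v} e → begin
          u                       ≡⟨ removeAt-fill k u ⟨
          removeAt (fill k u) k
            ≡⟨ cong (λ y → removeAt y k) (⊻-injective origin {fill k u} {fill k v}
                 (even-injective {origin ⊻ fill k u} {origin ⊻ fill k v} (even u) (even v)
                                       (trans (F-fill u) (trans e (sym (F-fill v)))))) ⟩
          removeAt (fill k v) k   ≡⟨ removeAt-fill k v ⟩
          v                       ∎
      ; surjective = λ v≤ →
          let x , e = surjective en v≤
              y     = origin ⊻ lift x
          in removeAt y k , trans (sym (F-removeAt y)) (trans (F-translate (lift x)) (trans (extend-lift m G x) e))
      ; bounded    = λ u → subst (_≤ K) (F-fill u) (E≤ (origin ⊻ fill k u))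
      }
      where
      even : ∀ u → parity (origin ⊻ fill k u) ≡ false
      even u = trans (parity-translate (fill k u)) (parity-fill k u)

  balanced⇒encode : ∃ λ c → ∀ x → G x ≡ encode c x
  balanced⇒encode =
    let l , e = dot-enumerates bs bs-enumerates
    -- The translation by `origin` goes into the negations of the layout.
    in (k , l ⊞ removeAt origin k) , λ x → begin
      G x                                                        ≡⟨ extend-lift m G x ⟨
      E (lift x)                                                 ≡⟨ F-translate (lift x) ⟨
      F (origin ⊻ lift x)                                        ≡⟨ F-removeAt (origin ⊻ lift x) ⟩
      dot bs (removeAt (origin ⊻ lift x) k)                      ≡⟨ e _ ⟩
      value l (removeAt (origin ⊻ lift x) k)                     ≡⟨ cong (value l) (removeAt-⊻ origin (lift x) k) ⟩
      value l (removeAt origin k ⊻ removeAt (lift x) k)          ≡⟨ value-⊞ l (removeAt origin k) (removeAt (lift x) k) ⟨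
      value (l ⊞ removeAt origin k) (removeAt (lift x) k)        ∎

-- The magic constant, by summation over the whole cube.

∑-const : ∀ n c → ∑ {n} (λ _ → c) ≡ n * c
∑-const zero    c = refl
∑-const (suc n) c = cong (c +_) (∑-const n c)

-- Gauss's pairing of each number with its reflection.
∑-toℕ : ∀ K → 2 * ∑ {suc K} toℕ ≡ suc K * K
∑-toℕ K = begin
  2 * S                                              ≡⟨ cong (S +_) (ℕ.+-identityʳ S) ⟩
  S + S                                              ≡⟨ cong (S +_) (sum-permute {suc K} {suc K} toℕ reverse) ⟩
  S + ∑ {suc K} (λ j → toℕ (opposite j))            ≡⟨ ∑-distrib-+ {suc K} toℕ (toℕ ∘ opposite) ⟨
  ∑ {suc K} (λ j → toℕ j + toℕ (opposite j))
    ≡⟨ sum-cong-≗ {suc K} (λ j → trans (cong (toℕ j +_) (opposite-prop j)) (ℕ.m+[n∸m]≡n (ℕ.≤-pred (toℕ<n j)))) ⟩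
  ∑ {suc K} (λ _ → K)                               ≡⟨ ∑-const (suc K) K ⟩
  suc K * K                                          ∎
  where
  S : ℕ
  S = ∑ {suc K} toℕ

module _ {G : Cube n → ℕ} (en : Enumerates G) where
  private
    N : ℕ
    N = suc (maxValue n)

    point : Fin N → Cube n
    point j = proj₁ (surjective en (ℕ.≤-pred (toℕ<n j)))

    rank : Cube n → Fin N
    rank x = fromℕ< (s≤s (bounded en x))

    toℕ-rank : ∀ x → toℕ (rank x) ≡ G x
    toℕ-rank x = toℕ-fromℕ< (s≤s (bounded en x))

    G-point : ∀ j → G (point j) ≡ toℕ j
    G-point j = proj₂ (surjective en (ℕ.≤-pred (toℕ<n j)))

    rank-point : ∀ j → rank (point j) ≡ j
    rank-point j = toℕ-injective (trans (toℕ-rank (point j)) (G-point j))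

    point-rank : ∀ x → point (rank x) ≡ x
    point-rank x = injective en (trans (G-point (rank x)) (toℕ-rank x))

    T : ℕ
    T = ∑ {N} toℕ

    -- Conjugation with the enumeration turns the bijection `φ` into a permutation of the ranks.
    ∑-reindex : (φ ψ : Cube n → Cube n) → (∀ x → φ (ψ x) ≡ x) → (∀ x → ψ (φ x) ≡ x) →
                ∑ (λ j → G (φ (point j))) ≡ T
    ∑-reindex φ ψ φψ ψφ = begin
      ∑ (λ j → G (φ (point j)))           ≡⟨ sum-cong-≗ (λ j → sym (toℕ-rank (φ (point j)))) ⟩
      ∑ (λ j → toℕ (rank (φ (point j))))  ≡⟨ sum-permute toℕ π ⟨
      T                                    ∎
      where
      conjugate : (φ ψ : Cube n → Cube n) → (∀ x → φ (ψ x) ≡ x) →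
                  ∀ j → rank (φ (point (rank (ψ (point j))))) ≡ j
      conjugate φ ψ φψ j = trans (cong (rank ∘ φ) (point-rank _)) (trans (cong rank (φψ (point j))) (rank-point j))

      π = permutation (rank ∘ φ ∘ point) (rank ∘ ψ ∘ point) (conjugate φ ψ φψ) (conjugate ψ φ ψφ)

  -- Summing over all cube points evaluates the constant, as G takes every value once.
  quadruple-constant : ∀ {S} (k l : Fin n) →
    (∀ x → G x + G (toggle x k) + (G (toggle x l) + G (toggle (toggle x k) l)) ≡ S) →
    S ≡ 2 * maxValue n
  quadruple-constant {S} k l quad = ℕ.*-cancelˡ-≡ _ _ N (begin
    N * S                                ≡⟨ ∑-const N S ⟨
    ∑ {N} (λ _ → S)                     ≡⟨ sum-cong-≗ (λ j → sym (quad (point j))) ⟩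
    ∑ (λ j → f j + g j + (h j + q j))   ≡⟨ ∑-distrib-+ (λ j → f j + g j) (λ j → h j + q j) ⟩
    ∑ (λ j → f j + g j) + ∑ (λ j → h j + q j)  ≡⟨ cong₂ _+_ (∑-distrib-+ f g) (∑-distrib-+ h q) ⟩
    (∑ f + ∑ g) + (∑ h + ∑ q)        ≡⟨ cong₂ _+_ (cong₂ _+_ ∑f ∑g) (cong₂ _+_ ∑h ∑q) ⟩
    (T + T) + (T + T)                    ≡⟨ double T ⟩
    2 * (2 * T)                          ≡⟨ cong (2 *_) (∑-toℕ (maxValue n)) ⟩
    2 * (N * maxValue n)                 ≡⟨ exchange N (maxValue n) ⟩
    N * (2 * maxValue n)                 ∎)
    where
    f g h q : Fin N → ℕ
    f j = G (point j)
    g j = G (toggle (point j) k)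
    h j = G (toggle (point j) l)
    q j = G (toggle (toggle (point j) k) l)

    ∑f : ∑ f ≡ T
    ∑f = ∑-reindex id id (λ _ → refl) (λ _ → refl)

    ∑g : ∑ g ≡ T
    ∑g = ∑-reindex (λ x → toggle x k) (λ x → toggle x k) (λ x → toggle-involutive x k) (λ x → toggle-involutive x k)

    ∑h : ∑ h ≡ T
    ∑h = ∑-reindex (λ x → toggle x l) (λ x → toggle x l) (λ x → toggle-involutive x l) (λ x → toggle-involutive x l)

    undo : ∀ k l (x : Cube n) → toggle (toggle (toggle (toggle x k) l) l) k ≡ x
    undo k l x = trans (cong (λ y → toggle y k) (toggle-involutive (toggle x k) l)) (toggle-involutive x k)

    ∑q : ∑ q ≡ T
    ∑q = ∑-reindex (λ x → toggle (toggle x k) l) (λ x → toggle (toggle x l) k) (undo l k) (undo k l)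

    double : ∀ t → (t + t) + (t + t) ≡ 2 * (2 * t)
    double = solve-∀

    exchange : ∀ a b → 2 * (a * b) ≡ a * (2 * b)
    exchange = solve-∀

-- Positions as bit vectors.

-- Gray code: a step in ℤ/4 changes exactly one of the two bits hi and lo.
hi lo : ℤ/4 → Bool
hi 0F = false
hi 1F = false
hi 2F = true
hi 3F = true
lo 0F = false
lo 1F = true
lo 2F = true
lo 3F = false

ungray : Bool → Bool → ℤ/4
ungray false false = 0F
ungray false true  = 1F
ungray true  true  = 2F
ungray true  false = 3F

bits : Position m → Cube (m * 2)
bits []      = []
bits (x ∷ p) = hi x ∷ lo x ∷ bits p

position : ∀ m → Cube (m * 2) → Position m
position zero    []          = []
position (suc m) (a ∷ b ∷ x) = ungray a b ∷ position m x

position-bits : (p : Position m) → position m (bits p) ≡ p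
position-bits []      = refl
position-bits (x ∷ p) = cong₂ _∷_ (ungray-gray x) (position-bits p)
  where
  ungray-gray : ∀ x → ungray (hi x) (lo x) ≡ x
  ungray-gray 0F = refl
  ungray-gray 1F = refl
  ungray-gray 2F = refl
  ungray-gray 3F = refl

bits-position : ∀ m (x : Cube (m * 2)) → bits (position m x) ≡ x
bits-position zero    []          = refl
bits-position (suc m) (a ∷ b ∷ x) = trans (gray-ungray a b) (cong (λ y → a ∷ b ∷ y) (bits-position m x))
  where
  gray-ungray : ∀ a b {n} {y : Cube n} → _≡_ {A = Cube (suc (suc n))} (hi (ungray a b) ∷ lo (ungray a b) ∷ y) (a ∷ b ∷ y)
  gray-ungray false false = refl
  gray-ungray false true  = refl
  gray-ungray true  false = refl
  gray-ungray true  true  = refl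

-- The place in `bits` of the `hi` bit (`false`) or the `lo` bit (`true`) of a coordinate.
axis : Fin m → Bool → Fin (m * 2)
axis zero    false = zero
axis zero    true  = suc zero
axis (suc i) b     = suc (suc (axis i b))

-- The neighbour on the 4-cycle whose Gray code differs in the bit selected as in `axis`.
turn : Bool → ℤ/4 → ℤ/4
turn false 0F = 3F
turn false 1F = 2F
turn false 2F = 1F
turn false 3F = 0F
turn true  0F = 1F
turn true  1F = 0F
turn true  2F = 3F
turn true  3F = 2F

axis-surjective : ∀ m (k : Fin (m * 2)) → ∃₂ λ (i : Fin m) b → k ≡ axis i b
axis-surjective (suc m) zero          = zero , false , refl
axis-surjective (suc m) (suc zero)    = zero , true , refl
axis-surjective (suc m) (suc (suc k)) =
  let i , b , e = axis-surjective m k in suc i , b , cong (λ j → suc (suc j)) e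

axis-injective : ∀ (i j : Fin m) {b c} → axis i b ≡ axis j c → i ≡ j
axis-injective zero    zero    _ = refl
axis-injective zero    (suc j) {false} ()
axis-injective zero    (suc j) {true}  ()
axis-injective (suc i) zero    {c = false} ()
axis-injective (suc i) zero    {c = true}  ()
axis-injective (suc i) (suc j) e = cong suc (axis-injective i j (suc-injective (suc-injective e)))

axis-false≢true : (i : Fin m) → axis i false ≢ axis i true
axis-false≢true (suc i) e = axis-false≢true i (suc-injective (suc-injective e))

bits-turn : ∀ (p : Position m) i b → bits (p [ i ]%= turn b) ≡ toggle (bits p) (axis i b)
bits-turn (0F ∷ p) zero false = refl
bits-turn (1F ∷ p) zero false = refl
bits-turn (2F ∷ p) zero false = refl
bits-turn (3F ∷ p) zero false = refl
bits-turn (0F ∷ p) zero true  = refl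
bits-turn (1F ∷ p) zero true  = refl
bits-turn (2F ∷ p) zero true  = refl
bits-turn (3F ∷ p) zero true  = refl
bits-turn (x ∷ p) (suc i) b = cong (λ y → hi x ∷ lo x ∷ y) (bits-turn p i b)

set-turn : ∀ (p : Position m) i u b → (p [ i ]≔ u) [ i ]%= turn b ≡ p [ i ]≔ turn b u
set-turn p i u b = updateAt-updateAt i p

set-set-turn : ∀ (p : Position m) {i j} → i ≢ j → ∀ u v b →
               (p [ i ]≔ u [ j ]≔ v) [ i ]%= turn b ≡ p [ i ]≔ turn b u [ j ]≔ v
set-set-turn p {i} {j} i≢j u v b =
  trans (updateAt-commutes i j i≢j (p [ i ]≔ u)) (cong (_[ j ]≔ v) (set-turn p i u b))

set-lookup : (p : Position m) (i : Fin m) → p [ i ]≔ lookup p i ≡ p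
set-lookup p i = trans (updateAt-cong-local i p refl) (updateAt-id i p)

step-turn : ∀ u → ∃ λ b → u ⊕ 1F ≡ turn b u
step-turn 0F = true  , refl
step-turn 1F = false , refl
step-turn 2F = true  , refl
step-turn 3F = false , refl

-- A turn runs along an edge of the 4-cycle, and `s` is the end from which the edge is a step by 1.
-- Stating this for all `h` allows its use in two coordinates in succession.
turn-edge : ∀ b u → ∃ λ s → ∀ (h : ℤ/4 → ℕ) → h u + h (turn b u) ≡ h s + h (s ⊕ 1F)
turn-edge false 0F = 3F , λ h → ℕ.+-comm (h 0F) (h 3F)
turn-edge false 1F = 1F , λ h → refl
turn-edge false 2F = 1F , λ h → ℕ.+-comm (h 2F) (h 1F)
turn-edge false 3F = 3F , λ h → refl
turn-edge true  0F = 0F , λ h → refl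
turn-edge true  1F = 0F , λ h → ℕ.+-comm (h 1F) (h 0F)
turn-edge true  2F = 2F , λ h → refl
turn-edge true  3F = 2F , λ h → ℕ.+-comm (h 3F) (h 2F)

-- Turning by neither, either or both bits visits all of `ℤ/4`, so the face spanned by the two bits
-- of one coordinate is an orthogonal line.
turns-line : ∀ (h : ℤ/4 → ℕ) u b →
  h u + h (turn b u) + (h (turn (not b) u) + h (turn (not b) (turn b u))) ≡ h 0F + (h 1F + (h 2F + (h 3F + 0)))
turns-line h = go
  where
  p₁ : ∀ a b c d → a + d + (b + c) ≡ a + (b + (c + (d + 0)))
  p₁ = solve-∀
  p₂ : ∀ a b c d → b + c + (a + d) ≡ a + (b + (c + (d + 0)))
  p₂ = solve-∀
  p₃ : ∀ a b c d → c + b + (d + a) ≡ a + (b + (c + (d + 0)))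
  p₃ = solve-∀
  p₄ : ∀ a b c d → d + a + (c + b) ≡ a + (b + (c + (d + 0)))
  p₄ = solve-∀
  p₅ : ∀ a b c d → a + b + (d + c) ≡ a + (b + (c + (d + 0)))
  p₅ = solve-∀
  p₆ : ∀ a b c d → b + a + (c + d) ≡ a + (b + (c + (d + 0)))
  p₆ = solve-∀
  p₇ : ∀ a b c d → c + d + (b + a) ≡ a + (b + (c + (d + 0)))
  p₇ = solve-∀
  p₈ : ∀ a b c d → d + c + (a + b) ≡ a + (b + (c + (d + 0)))
  p₈ = solve-∀

  go : ∀ u b → h u + h (turn b u) + (h (turn (not b) u) + h (turn (not b) (turn b u)))
             ≡ h 0F + (h 1F + (h 2F + (h 3F + 0)))
  go 0F false = p₁ (h 0F) (h 1F) (h 2F) (h 3F)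
  go 1F false = p₂ (h 0F) (h 1F) (h 2F) (h 3F)
  go 2F false = p₃ (h 0F) (h 1F) (h 2F) (h 3F)
  go 3F false = p₄ (h 0F) (h 1F) (h 2F) (h 3F)
  go 0F true  = p₅ (h 0F) (h 1F) (h 2F) (h 3F)
  go 1F true  = p₆ (h 0F) (h 1F) (h 2F) (h 3F)
  go 2F true  = p₇ (h 0F) (h 1F) (h 2F) (h 3F)
  go 3F true  = p₈ (h 0F) (h 1F) (h 2F) (h 3F)

4^m≡suc-maxValue : ∀ m → 4 ^ m ≡ suc (maxValue (m * 2))
4^m≡suc-maxValue m = begin
  (2 ^ 2) ^ m             ≡⟨ ℕ.^-*-assoc 2 2 m ⟩
  2 ^ (2 * m)             ≡⟨ cong (2 ^_) (ℕ.*-comm 2 m) ⟩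
  2 ^ (m * 2)             ≡⟨ suc-maxValue (m * 2) ⟨
  suc (maxValue (m * 2))  ∎

-- Compactness of an arrangement as balance of its levels.

module _ (a : Arrangement m) where
  level : Cube (m * 2) → ℕ
  level x = toℕ (index a (position m x))

  level-bits : ∀ p → level (bits p) ≡ toℕ (index a p)
  level-bits p = cong (λ q → toℕ (index a q)) (position-bits p)

  level-enumerates : Enumerates level
  level-enumerates = record
    { injective  = λ {x} {y} e → begin
        x                      ≡⟨ bits-position m x ⟨
        bits (position m x)    ≡⟨ cong bits (Bijection.injective a (toℕ-injective e)) ⟩
        bits (position m y)    ≡⟨ bits-position m y ⟩
        y                      ∎
    ; surjective = λ {v} v≤ →
        let v<    = subst (v <_) (sym (4^m≡suc-maxValue m)) (s≤s v≤)
            p , e = Bijection.strictlySurjective a (fromℕ< v<)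
        in bits p , trans (level-bits p) (trans (cong toℕ e) (toℕ-fromℕ< v<))
    ; bounded    = λ x → ℕ.≤-pred (subst (toℕ (index a (position m x)) <_) (4^m≡suc-maxValue m) (toℕ<n _))
    }

  -- A face of the bit cube read in positions: an orthogonal line if `i` equals `j` and `b` differs
  -- from `c`, a subsquare if `i` differs from `j`.
  corners : Position m → Fin m → Bool → Fin m → Bool → ℕ
  corners p i b j c =
    entry a p + entry a (p [ i ]%= turn b) + (entry a (p [ j ]%= turn c) + entry a (p [ i ]%= turn b [ j ]%= turn c))

  -- The summand 4 arises because entries count from 1 and levels from 0.
  corners-level : ∀ p i b j c → corners p i b j c ≡
    4 + (level (bits p) + level (toggle (bits p) (axis i b)) +
         (level (toggle (bits p) (axis j c)) + level (toggle (toggle (bits p) (axis i b)) (axis j c))))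
  corners-level p i b j c = begin
    corners p i b j c
      ≡⟨ cong₂ _+_ (cong₂ _+_ (at p refl) (at _ (bits-turn p i b)))
                   (cong₂ _+_ (at _ (bits-turn p j c))
                              (at _ (trans (bits-turn (p [ i ]%= turn b) j c)
                                           (cong (λ y → toggle y (axis j c)) (bits-turn p i b))))) ⟩
    suc (level x) + suc (level (toggle x k)) + (suc (level (toggle x l)) + suc (level (toggle (toggle x k) l)))
      ≡⟨ collect (level x) _ _ _ ⟩
    4 + (level x + level (toggle x k) + (level (toggle x l) + level (toggle (toggle x k) l))) ∎
    where
    x = bits p
    k = axis i b
    l = axis j c

    at : ∀ p {y} → bits p ≡ y → entry a p ≡ suc (level y)
    at p refl = cong suc (sym (level-bits p))

    collect : ∀ p q r s → suc p + suc q + (suc r + suc s) ≡ 4 + (p + q + (r + s))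
    collect = solve-∀

  balanced⇒corners : Balanced level → ∀ p {i b j c} → axis i b ≢ axis j c →
                     corners p i b j c ≡ 4 + 2 * maxValue (m * 2)
  balanced⇒corners balanced p {i} {b} {j} {c} k≢l =
    trans (corners-level p i b j c) (cong (4 +_) (balanced (bits p) k≢l))

  balanced⇒compact : Balanced level → IsCompactMagic a (4 + 2 * maxValue (m * 2))
  balanced⇒compact balanced = record { lines = lines′ ; subsquares = subsquares′ }
    where
    lines′ : ∀ p i → lineSum a p i ≡ 4 + 2 * maxValue (m * 2)
    lines′ p i = begin
      lineSum a p i
        ≡⟨ turns-line (λ t → entry a (p [ i ]≔ t)) 0F false ⟨
      entry a (p [ i ]≔ 0F) + entry a (p [ i ]≔ turn false 0F) +
        (entry a (p [ i ]≔ turn true 0F) + entry a (p [ i ]≔ turn true (turn false 0F)))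
        ≡⟨ cong₂ (λ q r → entry a (p [ i ]≔ 0F) + entry a q + r) (set-turn p i 0F false)
             (cong₂ (λ q r → entry a q + entry a r) (set-turn p i 0F true)
                (trans (cong (λ q → q [ i ]%= turn true) (set-turn p i 0F false)) (set-turn p i 3F true))) ⟨
      corners (p [ i ]≔ 0F) i false i true
        ≡⟨ balanced⇒corners balanced (p [ i ]≔ 0F) (axis-false≢true i) ⟩
      4 + 2 * maxValue (m * 2) ∎

    subsquares′ : ∀ p {i j} → i ≢ j → ∀ x y → subsquareSum a p i j x y ≡ 4 + 2 * maxValue (m * 2)
    -- Each step by 1 is replaced by the turn in the one bit that it changes.
    subsquares′ p {i} {j} i≢j x y with x ⊕ 1F | step-turn x | y ⊕ 1F | step-turn y
    ... | _ | b , refl | _ | c , refl = begin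
      at x y + at (turn b x) y + at x (turn c y) + at (turn b x) (turn c y)
        ≡⟨ ℕ.+-assoc (at x y + at (turn b x) y) _ _ ⟩
      at x y + at (turn b x) y + (at x (turn c y) + at (turn b x) (turn c y))
        ≡⟨ cong₂ (λ q r → at x y + entry a q + r) (set-set-turn p i≢j x y b)
             (cong₂ (λ q r → entry a q + entry a r) (set-turn (p [ i ]≔ x) j y c)
                (trans (cong (λ q → q [ j ]%= turn c) (set-set-turn p i≢j x y b)) (set-turn (p [ i ]≔ turn b x) j y c))) ⟨
      corners (p [ i ]≔ x [ j ]≔ y) i b j c
        ≡⟨ balanced⇒corners balanced (p [ i ]≔ x [ j ]≔ y) (i≢j ∘ axis-injective i j) ⟩
      4 + 2 * maxValue (m * 2) ∎
      where
      at : ℤ/4 → ℤ/4 → ℕ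
      at u v = entry a (p [ i ]≔ u [ j ]≔ v)

  module _ {M : ℕ} (compact : IsCompactMagic a M) where
    open IsCompactMagic compact

    corners-same : ∀ p i b → corners p i b i (not b) ≡ M
    corners-same p i b = begin
      corners p i b i (not b)
        ≡⟨ cong (λ q → corners q i b i (not b)) (set-lookup p i) ⟨
      corners (p [ i ]≔ u) i b i (not b)
        ≡⟨ cong₂ (λ q r → h u + entry a q + r) (set-turn p i u b)
             (cong₂ (λ q r → entry a q + entry a r) (set-turn p i u (not b))
                (trans (cong (λ q → q [ i ]%= turn (not b)) (set-turn p i u b)) (set-turn p i (turn b u) (not b)))) ⟩
      h u + h (turn b u) + (h (turn (not b) u) + h (turn (not b) (turn b u)))
        ≡⟨ turns-line h u b ⟩
      lineSum a p i
        ≡⟨ lines p i ⟩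
      M ∎
      where
      u = lookup p i

      h : ℤ/4 → ℕ
      h t = entry a (p [ i ]≔ t)

    -- Rewriting the edges as steps by 1, first in coordinate `i` and then in `j`, yields the
    -- subsquare with lower corner `s`, `t`, possibly one that wraps around.
    corners-distinct : ∀ p {i j} → i ≢ j → ∀ b c → corners p i b j c ≡ M
    corners-distinct p {i} {j} i≢j b c =
      let s , es = turn-edge b u
          t , et = turn-edge c v
      in begin
      corners p i b j c
        ≡⟨ cong (λ q → corners q i b j c) (trans (cong (_[ j ]≔ v) (set-lookup p i)) (set-lookup p j)) ⟨
      corners (p [ i ]≔ u [ j ]≔ v) i b j c
        ≡⟨ cong₂ (λ q r → h u v + entry a q + r) (set-set-turn p i≢j u v b)
             (cong₂ (λ q r → entry a q + entry a r) (set-turn (p [ i ]≔ u) j v c)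
                (trans (cong (λ q → q [ j ]%= turn c) (set-set-turn p i≢j u v b)) (set-turn (p [ i ]≔ turn b u) j v c))) ⟩
      h u v + h (turn b u) v + (h u (turn c v) + h (turn b u) (turn c v))
        ≡⟨ cong₂ _+_ (es (λ w → h w v)) (es (λ w → h w (turn c v))) ⟩
      h s v + h (s ⊕ 1F) v + (h s (turn c v) + h (s ⊕ 1F) (turn c v))
        ≡⟨ interchange (h s v) (h (s ⊕ 1F) v) (h s (turn c v)) (h (s ⊕ 1F) (turn c v)) ⟩
      h s v + h s (turn c v) + (h (s ⊕ 1F) v + h (s ⊕ 1F) (turn c v))
        ≡⟨ cong₂ _+_ (et (h s)) (et (h (s ⊕ 1F))) ⟩
      h s t + h s (t ⊕ 1F) + (h (s ⊕ 1F) t + h (s ⊕ 1F) (t ⊕ 1F))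
        ≡⟨ regroup (h s t) (h s (t ⊕ 1F)) (h (s ⊕ 1F) t) (h (s ⊕ 1F) (t ⊕ 1F)) ⟩
      subsquareSum a p i j s t
        ≡⟨ subsquares p i≢j s t ⟩
      M ∎
      where
      u = lookup p i
      v = lookup p j

      h : ℤ/4 → ℤ/4 → ℕ
      h u v = entry a (p [ i ]≔ u [ j ]≔ v)

      interchange : ∀ p q r s → p + q + (r + s) ≡ p + r + (q + s)
      interchange = solve-∀

      regroup : ∀ p q r s → p + q + (r + s) ≡ p + r + q + s
      regroup = solve-∀

    compact⇒corners : ∀ p {i b j c} → axis i b ≢ axis j c → corners p i b j c ≡ M
    compact⇒corners p {i} {b} {j} {c} k≢l with i ≟ j
    ... | no  i≢j  = corners-distinct p i≢j b c
    compact⇒corners p {i} {false} {.i} {false} k≢l | yes refl = contradiction refl k≢l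
    compact⇒corners p {i} {false} {.i} {true}  k≢l | yes refl = corners-same p i false
    compact⇒corners p {i} {true}  {.i} {false} k≢l | yes refl = corners-same p i true
    compact⇒corners p {i} {true}  {.i} {true}  k≢l | yes refl = contradiction refl k≢l

    quadruple : ∀ x {k l} → k ≢ l →
      4 + (level x + level (toggle x k) + (level (toggle x l) + level (toggle (toggle x k) l))) ≡ M
    quadruple x {k} {l} k≢l with axis-surjective m k | axis-surjective m l
    ... | i , b , refl | j , c , refl = begin
      quad x                               ≡⟨ cong quad (bits-position m x) ⟨
      quad (bits (position m x))           ≡⟨ corners-level (position m x) i b j c ⟨
      corners (position m x) i b j c       ≡⟨ compact⇒corners (position m x) k≢l ⟩
      M                                    ∎
      where
      quad : Cube (m * 2) → ℕ
      quad x = 4 + (level x + level (toggle x (axis i b)) +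
                    (level (toggle x (axis j c)) + level (toggle (toggle x (axis i b)) (axis j c))))

    -- The given coordinate supplies two distinct bits, so `quadruple-constant` can be applied to
    -- the levels.
    compact-constant : Fin m → M ≡ 4 + 2 * maxValue (m * 2)
    compact-constant i = trans (sym M≡4+) (cong (4 +_)
      (quadruple-constant level-enumerates (axis i false) (axis i true) λ x →

      ℕ.+-cancelˡ-≡ 4 _ _ (trans (quadruple x (axis-false≢true i)) (sym M≡4+))))
      where
      -- Four entries, each at least 1, sum to `M`, so the subtraction is not truncated.
      M≡4+ : 4 + (M ∸ 4) ≡ M
      M≡4+ = ℕ.m+[n∸m]≡n (subst (4 ≤_) (quadruple 𝟎 (axis-false≢true i)) (ℕ.m≤m+n 4 _))

    compact⇒balanced : Fin m → Balanced level
    compact⇒balanced i x k≢l = ℕ.+-cancelˡ-≡ 4 _ _ (trans (quadruple x k≢l) (compact-constant i))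

-- Arrangements built from codes.

balanced-cong : {F G : Cube n → ℕ} → (∀ x → F x ≡ G x) → Balanced G → Balanced F
balanced-cong e balanced x {k} {l} k≢l = trans
  (cong₂ _+_ (cong₂ _+_ (e x) (e (toggle x k))) (cong₂ _+_ (e (toggle x l)) (e (toggle (toggle x k) l))))
  (balanced x k≢l)

module _ (m : ℕ) (c : Code (m * 2)) where
  private
    en : Enumerates (encode c)
    en = encode-enumerates m c

    encode< : ∀ (p : Position m) → encode c (bits p) < 4 ^ m
    encode< p = subst (encode c (bits p) <_) (sym (4^m≡suc-maxValue m)) (s≤s (bounded en (bits p)))

  arrange : Arrangement m
  arrange = mk⤖ {to = λ p → fromℕ< (encode< p)} (inj , strictlySurjective⇒surjective surj)
    where
    inj : ∀ {p q} → fromℕ< (encode< p) ≡ fromℕ< (encode< q) → p ≡ q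
    inj {p} {q} e = begin
      p                    ≡⟨ position-bits p ⟨
      position m (bits p)  ≡⟨ cong (position m) (injective en {bits p} {bits q}
                              (trans (sym (toℕ-fromℕ< (encode< p))) (trans (cong toℕ e) (toℕ-fromℕ< (encode< q))))) ⟩
      position m (bits q)  ≡⟨ position-bits q ⟩
      q                    ∎

    surj : ∀ j → ∃ λ p → fromℕ< (encode< p) ≡ j
    surj j =
      let x , e = surjective en (ℕ.≤-pred (subst (toℕ j <_) (4^m≡suc-maxValue m) (toℕ<n j)))
      in position m x , toℕ-injective (trans (toℕ-fromℕ< (encode< (position m x)))
           (trans (cong (encode c) (bits-position m x)) e))

  index-arrange : ∀ (p : Position m) → toℕ (index arrange p) ≡ encode c (bits p)
  index-arrange p = toℕ-fromℕ< (encode< p)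

  arrange-compact : IsCompactMagic arrange (4 + 2 * maxValue (m * 2))
  arrange-compact = balanced⇒compact arrange (balanced-cong {F = level arrange} {G = encode c}
    (λ x → trans (index-arrange (position m x)) (cong (encode c) (bits-position m x))) (encode-balanced c))

arrange-injective : ∀ m (c d : Code (m * 2)) → (∀ p → index (arrange m c) p ≡ index (arrange m d) p) → c ≡ d
arrange-injective m c d e = encode-injective m c d λ x → begin
  encode c x                                   ≡⟨ cong (encode c) (bits-position m x) ⟨
  encode c (bits (position m x))               ≡⟨ index-arrange m c (position m x) ⟨
  toℕ (index (arrange m c) (position m x))     ≡⟨ cong toℕ (e (position m x)) ⟩
  toℕ (index (arrange m d) (position m x))     ≡⟨ index-arrange m d (position m x) ⟩
  encode d (bits (position m x))               ≡⟨ cong (encode d) (bits-position m x) ⟩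
  encode d x                                   ∎

compact⇒encode : ∀ {M} (a : Arrangement m) → Fin m → IsCompactMagic a M → ∃ λ c → ∀ x → level a x ≡ encode c x
compact⇒encode {m} a i compact = balanced⇒encode m (level a) (level-enumerates a) (compact⇒balanced a compact i)

encode⇒arrange : ∀ (a : Arrangement m) {c} → (∀ x → level a x ≡ encode c x) → ∀ p → index (arrange m c) p ≡ index a p
encode⇒arrange {m} a {c} e p = toℕ-injective (begin
  toℕ (index (arrange m c) p)    ≡⟨ index-arrange m c p ⟩
  encode c (bits p)              ≡⟨ e (bits p) ⟨
  level a (bits p)               ≡⟨ level-bits a p ⟩
  toℕ (index a p)                ∎)

-- Pandiagonals and most-perfect arrangements.

along-antipode : ∀ x t ε → x ⊕ (t ⊕ 2F) ⊗ ⟦ ε ⟧ ≡ (x ⊕ t ⊗ ⟦ ε ⟧) ⊕ 2F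
-- Twice 1 and twice 3 are both 2 modulo 4; for each sign the sixteen cases are decided by
-- computation.
along-antipode x t Sign.+ = from-yes (all? λ x → all? λ t → x ⊕ (t ⊕ 2F) ⊗ 1F ≟ (x ⊕ t ⊗ 1F) ⊕ 2F) x t
along-antipode x t Sign.- = from-yes (all? λ x → all? λ t → x ⊕ (t ⊕ 2F) ⊗ 3F ≟ (x ⊕ t ⊗ 3F) ⊕ 2F) x t

-- Adding 2 in `ℤ/4` flips both Gray code bits.
bits-antipode : ∀ (p : Position m) d t → bits (along p d (t ⊕ 2F)) ≡ ∁ (bits (along p d t))
bits-antipode []      []      t = refl
bits-antipode (x ∷ p) (ε ∷ d) t
  rewrite along-antipode x t ε = gray-antipode (x ⊕ t ⊗ ⟦ ε ⟧) (bits-antipode p d t)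
  where
  gray-antipode : ∀ y {n} {u v : Cube n} → u ≡ v →
                  _≡_ {A = Cube (suc (suc n))} (hi (y ⊕ 2F) ∷ lo (y ⊕ 2F) ∷ u) (not (hi y) ∷ not (lo y) ∷ v)
  gray-antipode 0F refl = refl
  gray-antipode 1F refl = refl
  gray-antipode 2F refl = refl
  gray-antipode 3F refl = refl

module _ (m : ℕ) (l : Layout (m * 2)) where
  private
    a : Arrangement m
    a = arrange m (zero , l)

    K : ℕ
    K = maxValue (m * 2)

    twoApart′ : ∀ p d t → entry a (along p d t) + entry a (along p d (t ⊕ 2F)) ≡ 2 + K
    twoApart′ p d t = begin
      entry a (along p d t) + entry a (along p d (t ⊕ 2F))
        ≡⟨ cong₂ (λ u v → suc u + suc v) (index-arrange m (zero , l) (along p d t))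
             (trans (index-arrange m (zero , l) (along p d (t ⊕ 2F))) (cong (encode (zero , l)) (bits-antipode p d t))) ⟩
      suc (encode (zero , l) x) + suc (encode (zero , l) (∁ x))
        ≡⟨ cong suc (ℕ.+-suc (encode (zero , l) x) (encode (zero , l) (∁ x))) ⟩
      2 + (encode (zero , l) x + encode (zero , l) (∁ x))
        ≡⟨ cong (2 +_) (encode-zero-∁ m l x) ⟩
      2 + K ∎
      where x = bits (along p d t)

    double : ∀ k → (2 + k) + (2 + k) ≡ 4 + 2 * k
    double = solve-∀

  arrange-mostPerfect : IsMostPerfect a (4 + 2 * K)
  arrange-mostPerfect = record
    { isCompactMagic = arrange-compact m (zero , l)
    -- A pandiagonal splits into two pairs of points two apart.
    ; pandiagonals   = λ p d → begin
        pandiagonalSum a p d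
          ≡⟨ pair-up (entry a (along p d 0F)) (entry a (along p d 1F)) (entry a (along p d 2F)) (entry a (along p d 3F)) ⟩
        (entry a (along p d 0F) + entry a (along p d 2F)) + (entry a (along p d 1F) + entry a (along p d 3F))
          ≡⟨ cong₂ _+_ (twoApart′ p d 0F) (twoApart′ p d 1F) ⟩
        (2 + K) + (2 + K)
          ≡⟨ double K ⟩
        4 + 2 * K ∎
    ; twoApart       = λ p d t → trans (cong (2 *_) (twoApart′ p d t)) (double′ K)
    }
    where
    pair-up : ∀ p q r s → p + (q + (r + (s + 0))) ≡ (p + r) + (q + s)
    pair-up = solve-∀

    double′ : ∀ k → 2 * (2 + k) ≡ 4 + 2 * k
    double′ = solve-∀

-- Points two apart have complementary bit vectors. Once `M` is known, such a pair on a fixed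
-- pandiagonal supplies the hypothesis of `encode-∁⇒zero`, so the ignored coordinate is the added
-- one.
mostPerfect⇒encode : ∀ {M} (a : Arrangement m) → Fin m → IsMostPerfect a M →
                     ∃ λ l → ∀ x → level a x ≡ encode (zero , l) x
mostPerfect⇒encode {m} {M} a i perfect =
  let (k , l) , e = compact⇒encode a i isCompactMagic
      k≡zero      = encode-∁⇒zero m k l x₀ (antipodal (k , l) e)
  in l , λ x → trans (e x) (cong (λ j → encode (j , l) x) k≡zero)
  where
  open IsMostPerfect perfect

  p : Position m
  p = replicate m 0F

  d : Vec Sign m
  d = replicate m Sign.+

  x₀ : Cube (m * 2)
  x₀ = bits (along p d 0F)

  half-constant : ∀ u v → 2 * (suc u + suc v) ≡ 4 + 2 * (u + v)
  half-constant = solve-∀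

  antipodal : ∀ c → (∀ x → level a x ≡ encode c x) → encode c x₀ + encode c (∁ x₀) ≡ maxValue (m * 2)
  antipodal c e = ℕ.*-cancelˡ-≡ _ _ 2 (ℕ.+-cancelˡ-≡ 4 _ _ (begin
    4 + 2 * (encode c x₀ + encode c (∁ x₀))
      ≡⟨ cong₂ (λ u v → 4 + 2 * (u + v)) (e x₀) (e (∁ x₀)) ⟨
    4 + 2 * (level a x₀ + level a (∁ x₀))
      ≡⟨ half-constant (level a x₀) (level a (∁ x₀)) ⟨
    2 * (suc (level a x₀) + suc (level a (∁ x₀)))
      ≡⟨ cong₂ (λ u v → 2 * (suc u + suc v)) (level-bits a (along p d 0F))
           (trans (cong (level a) (sym (bits-antipode p d 0F))) (level-bits a (along p d 2F))) ⟩
    2 * (entry a (along p d 0F) + entry a (along p d 2F))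
      ≡⟨ twoApart p d 0F ⟩
    M
      ≡⟨ compact-constant a isCompactMagic i ⟩
    4 + 2 * maxValue (m * 2) ∎))

-- Counting layouts and codes.

layout↔Fin : ∀ n → Layout n ↔ Fin (2 ^ n * n !)
layout↔Fin zero    = ↔-sym 1↔⊤
layout↔Fin (suc n) = subst (λ N → Layout (suc n) ↔ Fin N) (rearrange n (2 ^ n) (n !))
  (↔-trans (↔-refl ×-↔ ↔-trans (↔-sym 2↔Bool ×-↔ layout↔Fin n) (↔-sym *↔×)) (↔-sym *↔×))
  where
  -- The factor `f + n * f` is the form to which `suc n !` reduces.
  rearrange : ∀ n p f → suc n * (2 * (p * f)) ≡ 2 * p * (f + n * f)
  rearrange = solve-∀

code↔Fin : ∀ n → Code n ↔ Fin (2 ^ n * suc n !)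
code↔Fin n = subst (λ N → Code n ↔ Fin N) (rearrange n (2 ^ n) (n !))
  (↔-trans (↔-refl ×-↔ layout↔Fin n) (↔-sym *↔×))
  where
  rearrange : ∀ n p f → suc n * (p * f) ≡ p * (f + n * f)
  rearrange = solve-∀

-- Surjectivity chooses a code for every element of the setoid, and injectivity makes this code
-- depend only on the equivalence class.
hasCardinality : ∀ (S : Setoid 0ℓ 0ℓ) {A : Set} {N} → A ↔ Fin N → (f : A → Setoid.Carrier S) →
                 (∀ x y → Setoid._≈_ S (f x) (f y) → x ≡ y) → (∀ s → ∃ λ x → Setoid._≈_ S (f x) s) →
                 HasCardinality S N
hasCardinality S ι f inj surj = record
  { to        = λ s → Inverse.to ι (code s)
  ; from      = λ j → f (Inverse.from ι j)
  ; to-cong   = λ {s} {t} s≈t → cong (Inverse.to ι) (code-cong s t s≈t)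
  ; from-cong = λ where refl → S.refl
  ; inverse   =
      (λ {j} {s} s≈ → trans (cong (Inverse.to ι) (inj _ _ (S.trans (proj₂ (surj s)) s≈))) (Inverse.inverseˡ ι refl))
    , (λ {s} → λ where refl → subst (λ x → f x S.≈ s) (sym (Inverse.inverseʳ ι refl)) (proj₂ (surj s)))
  }
  where
  module S = Setoid S

  code = λ s → proj₁ (surj s)

  code-cong : ∀ s t → s S.≈ t → code s ≡ code t
  code-cong s t s≈t = inj _ _ (S.trans (proj₂ (surj s)) (S.trans s≈t (S.sym (proj₂ (surj t)))))

corollary11 : ∀ (m : ℕ) → 1 ≤ m →
    HasCardinality (compactSetoid m) (4 ^ m * (2 * m + 1) !) ×
    HasCardinality (mostPerfectSetoid m) (4 ^ m * (2 * m) !)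
corollary11 m@(suc _) (s≤s z≤n) =
    hasCardinality (compactSetoid m)
      (subst (λ N → Code (m * 2) ↔ Fin N)
        (cong₂ (λ N k → N * k !) 2^[m*2] (trans (cong suc (ℕ.*-comm m 2)) (ℕ.+-comm 1 (2 * m))))
        (code↔Fin (m * 2)))
      (λ c → arrange m c , _ , arrange-compact m c)
      (arrange-injective m)
      -- The coordinate `zero` exists because `m` is at least 1.
      (λ (a , _ , compact) → let c , e = compact⇒encode a zero compact in c , encode⇒arrange a {c} e)
  , hasCardinality (mostPerfectSetoid m)
      (subst (λ N → Layout (m * 2) ↔ Fin N) (cong₂ (λ N k → N * k !) 2^[m*2] (ℕ.*-comm m 2))
        (layout↔Fin (m * 2)))
      (λ l → arrange m (zero , l) , _ , arrange-mostPerfect m l)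
      (λ l l′ e → cong proj₂ (arrange-injective m (zero , l) (zero , l′) e))
      (λ (a , _ , perfect) → let l , e = mostPerfect⇒encode a zero perfect in l , encode⇒arrange a {zero , l} e)
  where
  2^[m*2] : 2 ^ (m * 2) ≡ 4 ^ m
  2^[m*2] = trans (sym (suc-maxValue (m * 2))) (sym (4^m≡suc-maxValue m))
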